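{- For every integer $n \geq 0$, \[ \sum_{v \in \{N,E\}^n} \#\{(v_1,v_2) \in \mathrm{Tam}(v)^2 : v_1 \leq_v v_2\} = \frac{2\,(3n+3)!}{(n+2)!\,(2n+3)!}, \] where the sum runs over all $2^n$ grid paths $v$ of size $n$.
   Context: A grid path is a finite walk on $\mathbb{Z}^2$ starting at $(0,0)$ made of north steps $N=(0,1)$ and east steps $E=(1,0)$; its size is its number of steps. For a grid path $v$, $\mathrm{Tam}(v)$ is the set of grid paths with the same endpoints as $v$ that stay weakly above $v$. For $v_1 \in \mathrm{Tam}(v)$ and a lattice point $p$ on $v_1$, the horizontal distance $\mathrm{horiz}_v(p)$ is the maximum number of east steps one can take starting from $p$ without crossing $v$. If in $v_1$ the point $p$ is preceded by an $E$ step and followed by an $N$ step, let $p'$ be the first lattice point of $v_1$ after $p$ with $\mathrm{horiz}_v(p')=\mathrm{horiz}_v(p)$, and let $v_1'$ be the path obtained from $v_1$ by exchanging the $E$ step just before $p$ with the subpath of $v_1$ from $p$ to $p'$; then $v_1' \in \mathrm{Tam}(v)$ and we declare $v_1 \prec_v v_1'$. The partial order $\leq_v$ on $\mathrm{Tam}(v)$ is the reflexive–transitive closure of $\prec_v$ (it makes $\mathrm{Tam}(v)$ a lattice). An interval of $\mathrm{Tam}(v)$ is a pair $(v_1,v_2)$ with $v_1 \leq_v v_2$. -}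

module Defs where

open import Data.Nat using (ℕ; zero; suc; _+_; _∸_; _<_)
open import Data.Product using (_×_; _,_; ∃-syntax)
open import Data.List using (List; []; _∷_; _++_; [_]; map; length; take)
open import Data.List.Relation.Unary.Unique.Propositional using (Unique)
open import Data.List.Membership.Propositional using (_∈_)
open import Relation.Binary.PropositionalEquality using (_≡_; _≢_)
open import Relation.Binary.Construct.Closure.ReflexiveTransitive using (Star)
open import Function.Bundles using (_⇔_)

-- Steps: N = (0,1), E = (1,0).
data Step : Set where
  N E : Step

-- A grid path starting at (0,0), given by its list of steps.
Path : Set
Path = List Step

#E #N : Path → ℕ
#E [] = 0
#E (E ∷ p) = suc (#E p)
#E (N ∷ p) = #E p
#N [] = 0
#N (N ∷ p) = suc (#N p)
#N (E ∷ p) = #N p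

endpoint : Path → ℕ × ℕ
endpoint p = #E p , #N p

allPaths : ℕ → List Path
allPaths zero = [] ∷ []
allPaths (suc n) = map (N ∷_) (allPaths n) ++ map (E ∷_) (allPaths n)

-- Weakly above: same length, and after each number k of steps the
-- y-coordinate of v₁ is at least that of v (both lie on the antidiagonal x+y=k).
WeaklyAbove : Path → Path → Set
WeaklyAbove v₁ v = length v₁ ≡ length v × (∀ k → #N (take k v) Data.Nat.≤ #N (take k v₁))

Tam : Path → Path → Set
Tam v v₁ = endpoint v₁ ≡ endpoint v × WeaklyAbove v₁ v

-- x-coordinate of the rightmost point of v at height y
-- (number of E steps of v before its (y+1)-th N step).
xmax : Path → ℕ → ℕ
xmax [] y = 0
xmax (E ∷ v) y = suc (xmax v y)
xmax (N ∷ v) zero = 0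
xmax (N ∷ v) (suc y) = xmax v y

-- horiz_v(p): maximal number of east steps from p = (x,y) without crossing v.
horiz : Path → ℕ × ℕ → ℕ
horiz v (x , y) = xmax v y ∸ x

-- The point p' at the end of B (following the prefix P ending at p) is the
-- first lattice point after p with the same horizontal distance as p.
FirstSameHoriz : Path → Path → Path → Set
FirstSameHoriz v P B =
  horiz v (endpoint (P ++ B)) ≡ horiz v (endpoint P) ×
  (∀ k → 0 < k → k < length B →
     horiz v (endpoint (P ++ take k B)) ≢ horiz v (endpoint P))

-- Covering relation ≺_v : v₁ = A E B C with p the point after A E, B starting
-- with N and ending at p'; v₁' = A B E C.
data Cover (v : Path) : Path → Path → Set where
  cover : (A B′ C : Path) →
          Tam v (A ++ E ∷ (N ∷ B′) ++ C) →
          FirstSameHoriz v (A ++ [ E ]) (N ∷ B′) →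
          Cover v (A ++ E ∷ (N ∷ B′) ++ C) (A ++ (N ∷ B′) ++ E ∷ C)

_≤[_]_ : Path → Path → Path → Set
v₁ ≤[ v ] v₂ = Star (Cover v) v₁ v₂

Interval : Path → Path × Path → Set
Interval v (v₁ , v₂) = Tam v v₁ × Tam v v₂ × v₁ ≤[ v ] v₂

HasCard : {A : Set} → (A → Set) → ℕ → Set
HasCard {A} P k = ∃[ L ] (Unique L × (∀ (x : A) → (x ∈ L) ⇔ P x) × length L ≡ k)

{-# OPTIONS --safe #-}
-- A path above v is read as a word in which an N step opens as many units as the next row
-- of v has E steps, and every E step closes the last open unit; horiz_v is the number of
-- open units, and a cover moves a closing letter past the next prime (minimal excursion).
-- Prefixing N makes every word an excursion. In an interval, cut the upper word where the
-- last unit of its first letter is closed, and delete that unit: what remains is an interval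
-- of excursions together with the choice of a prime of its lower word, and a second interval.
-- So F(x), counting intervals by size (τ) and by primes of the lower word (x), satisfies
--   F(x) = 1 + τ x F(x) (1 + (F(x) - F(1)) / (x - 1)).
-- Let T = 1 + τ T³. Expanding this equation to first order at x = T forces F(T) = T and
-- F(1) = 3 T - T² - 1, and the coefficients of T and T² are explicit.
module Submission where

-- The equation for `F(x)` also contains the unknown `F(1)`. At order 0 in `x - T` there are two
-- equations for three unknowns: `F(T)`, `F(1)` and the divided difference `D(T)`. Order 1 brings
-- two more equations and the two unknown derivatives. The point `T` is the one where the terms with
-- the derivative of `D` cancel, as in the kernel method; the equation that is left then fixes
-- `D(T) = T - 1`, and the rest follows. All series have coefficients in ℕ. Differences are
-- therefore moved to the other side, `T - 1` is written as `τ T³`, and divided differences are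
-- geometric sums. Infinite sums over trees are replaced by finite ones modulo a power of `τ`. All
-- `v` of size `n` are treated at once: the letter made from the added N carries the initial E run
-- of `v`, so they correspond to excursions with `n + 1` letters, and the coefficient wanted is that
-- of `τ^(n+1)`.

-- Words, descents and first passages

module Words where
  open import Data.Nat using (ℕ; zero; suc; _+_; _∸_; _≤_; _<_; z≤n; s≤s)
  open import Data.Nat.Properties
  open import Data.Fin using (Fin; toℕ; fromℕ<)
  open import Data.Fin.Properties using (toℕ<n; toℕ-injective; toℕ-fromℕ<)
  open import Data.Product using (_×_; _,_; ∃-syntax; proj₁; proj₂)
  open import Data.Sum using (_⊎_; inj₁; inj₂)
  open import Data.List using (List; []; _∷_; _++_; [_]; length; take; drop; concat)
  open import Data.List.Properties
    using (++-assoc; ++-identityʳ; length-++; length-drop; ∷-injective; ∷-injectiveʳ; take++drop≡id; concat-++)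
  open import Data.List.Relation.Unary.All using (All; []; _∷_)
  import Data.List.Relation.Unary.All.Properties as All
  open import Relation.Nullary using (¬_; contradiction)
  open import Relation.Binary.Construct.Closure.ReflexiveTransitive using (Star; ε; _◅_; _◅◅_; gmap)
  open import Relation.Binary.PropositionalEquality using (_≡_; refl; sym; trans; cong; cong₂; subst; subst₂)

  -- A path over v = E^d₀ N E^d₁ N … is encoded by turning its i-th N step into push dᵢ
  -- and its E steps into pop: the running height of the word is then horiz_v.
  data Letter : Set where
    push : ℕ → Letter
    pop  : Letter

  Word : Set
  Word = List Letter

  private variable
    d e g h : ℕ
    l : Letter
    u v w w′ x y z : Word

  -- The word leads from height h down to 0, never going below 0.
  data Descent : ℕ → Word → Set where
    []   : Descent 0 []
    pop  : Descent h w → Descent (suc h) (pop ∷ w)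
    push : Descent (d + h) w → Descent h (push d ∷ w)

  -- As Descent, but height 0 is reached only at the end.
  data FirstPassage : ℕ → Word → Set where
    []   : FirstPassage 0 []
    pop  : FirstPassage h w → FirstPassage (suc h) (pop ∷ w)
    push : FirstPassage (d + suc h) w → FirstPassage (suc h) (push d ∷ w)

  descent-cast : h ≡ g → Descent h w → Descent g w
  descent-cast refl p = p

  descent-push⁻ : Descent 0 (push d ∷ w) → Descent d w
  descent-push⁻ (push p) = descent-cast (+-identityʳ _) p

  descent-push : Descent d w → Descent 0 (push d ∷ w)
  descent-push p = push (descent-cast (sym (+-identityʳ _)) p)

  firstPassage⇒descent : FirstPassage h w → Descent h w
  firstPassage⇒descent []       = []
  firstPassage⇒descent (pop p)  = pop (firstPassage⇒descent p)
  firstPassage⇒descent (push p) = push (firstPassage⇒descent p)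

  descent-++ : Descent h u → Descent g v → Descent (h + g) (u ++ v)
  descent-++ [] q = q
  descent-++ (pop p) q = pop (descent-++ p q)
  descent-++ {h} {g = g} (push {d = d} p) q =
    push (descent-cast (+-assoc d h g) (descent-++ p q))

  descent-∷ʳ-pop : ∀ h u → Descent h u → FirstPassage (suc h) (u ++ [ pop ])
  descent-∷ʳ-pop _ [] [] = pop []
  descent-∷ʳ-pop (suc h) (pop ∷ u) (pop p) = pop (descent-∷ʳ-pop h u p)
  descent-∷ʳ-pop h (push d ∷ u) (push p) =
    push (subst (λ m → FirstPassage m (u ++ [ pop ])) (sym (+-suc d h)) (descent-∷ʳ-pop (d + h) u p))

  -- No proper prefix of `w` lowers the height by `h`, while `u` lowers it by `h + g`; so `u` cannot
  -- end inside `w`. This locates the prime jumped by a cover relative to a cut of the word.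
  firstPassage-prefix : FirstPassage h w → Descent (h + g) u → w ++ x ≡ u ++ y →
    ∃[ c ] (u ≡ w ++ c × Descent g c × x ≡ c ++ y)
  firstPassage-prefix [] q eq = _ , refl , q , eq
  firstPassage-prefix (pop p) (pop q) eq with firstPassage-prefix p q (∷-injectiveʳ eq)
  ... | c , refl , q′ , eq′ = c , refl , q′ , eq′
  firstPassage-prefix (pop p) (push q) ()
  firstPassage-prefix {g = g} (push {d = d} {h = h} p) (push q) eq with ∷-injective eq
  ... | refl , eq₁
    with firstPassage-prefix p (descent-cast (sym (+-assoc d (suc h) g)) q) eq₁
  ... | c , refl , q′ , eq′ = c , refl , q′ , eq′

  firstPassage-unique : FirstPassage h u → FirstPassage h v → u ++ x ≡ v ++ y → u ≡ v × x ≡ y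
  firstPassage-unique [] [] eq = refl , eq
  firstPassage-unique (pop p) (pop q) eq with firstPassage-unique p q (∷-injectiveʳ eq)
  ... | refl , eq′ = refl , eq′
  firstPassage-unique (push p) (push q) eq with ∷-injective eq
  ... | refl , eq₁ with firstPassage-unique p q eq₁
  ... | refl , eq′ = refl , eq′

  -- Seen from height `h`, the displayed `pop` is the first letter to fall below 0, and a word has
  -- only one such place.
  descent-pop-unique : Descent h u → Descent h v → u ++ pop ∷ x ≡ v ++ pop ∷ y → u ≡ v × x ≡ y
  descent-pop-unique [] [] refl = refl , refl
  descent-pop-unique (pop p) (pop q) eq with descent-pop-unique p q (∷-injectiveʳ eq)
  ... | refl , eq′ = refl , eq′
  descent-pop-unique (push p) (push q) eq with ∷-injective eq
  ... | refl , eq₁ with descent-pop-unique p q eq₁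
  ... | refl , eq′ = refl , eq′

  -- The cut is at the first passage to 0, where the bottom one of the `suc h` units closes.
  descent-split : ∀ h w → Descent (suc h) w →
    ∃[ u ] ∃[ z ] (w ≡ u ++ pop ∷ z × Descent h u × Descent 0 z)
  descent-split zero (pop ∷ w) (pop p) = [] , w , refl , [] , p
  descent-split (suc h) (pop ∷ w) (pop p) with descent-split h w p
  ... | u , z , refl , pu , pz = pop ∷ u , z , refl , pop pu , pz
  descent-split h (push d ∷ w) (push p)
    with descent-split (d + h) w (descent-cast (+-suc d h) p)
  ... | u , z , refl , pu , pz = push d ∷ u , z , refl , push pu , pz

  -- The cover order on words

  infix 4 _⋖_ _≼_

  data _⋖_ : Word → Word → Set where
    here  : FirstPassage d u → pop ∷ push d ∷ u ++ v ⋖ push d ∷ u ++ pop ∷ v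
    there : w ⋖ w′ → l ∷ w ⋖ l ∷ w′

  _≼_ : Word → Word → Set
  _≼_ = Star _⋖_

  ⋖-length : w ⋖ w′ → length w ≡ length w′
  ⋖-length (here {u = u} {v = v} _) = cong suc (sym (trans (length-++ u)
    (trans (+-suc (length u) (length v)) (cong suc (sym (length-++ u))))))
  ⋖-length (there c) = cong suc (⋖-length c)

  ≼-length : w ≼ w′ → length w ≡ length w′
  ≼-length ε = refl
  ≼-length (c ◅ cs) = trans (⋖-length c) (≼-length cs)

  ⋖-++ʳ : ∀ z → w ⋖ w′ → w ++ z ⋖ w′ ++ z
  ⋖-++ʳ z (here {d = d} {u = u} {v = v} p) =
    subst₂ _⋖_ (cong (λ t → pop ∷ push d ∷ t) (sym (++-assoc u v z)))
      (cong (push d ∷_) (sym (++-assoc u (pop ∷ v) z))) (here p)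
  ⋖-++ʳ z (there c) = there (⋖-++ʳ z c)

  ⋖-++ˡ : ∀ z → w ⋖ w′ → z ++ w ⋖ z ++ w′
  ⋖-++ˡ [] c = c
  ⋖-++ˡ (_ ∷ z) c = there (⋖-++ˡ z c)

  ≼-++ʳ : ∀ z → w ≼ w′ → w ++ z ≼ w′ ++ z
  ≼-++ʳ z = gmap (_++ z) (⋖-++ʳ z)

  ≼-++ˡ : ∀ z → w ≼ w′ → z ++ w ≼ z ++ w′
  ≼-++ˡ z = gmap (z ++_) (⋖-++ˡ z)

  -- A cover can change the first letter only if this is a `pop`, so all moves happen behind a
  -- leading `push`.
  ≼-push : push d ∷ w ≼ x → ∃[ w′ ] (x ≡ push d ∷ w′ × w ≼ w′)
  ≼-push ε = _ , refl , ε
  ≼-push (there c ◅ cs) with ≼-push cs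
  ... | w′ , eq , cs′ = w′ , eq , c ◅ cs′

  firstPassage-suffix : FirstPassage h w → Descent (h + g) (w ++ x) → Descent g x
  firstPassage-suffix [] q = q
  firstPassage-suffix (pop p) (pop q) = firstPassage-suffix p q
  firstPassage-suffix {g = g} (push {d = d} {h = h} p) (push q) =
    firstPassage-suffix p (descent-cast (sym (+-assoc d (suc h) g)) q)

  ⋖-descent : w ⋖ w′ → Descent h w → Descent h w′
  ⋖-descent (here p) (pop (push q)) =
    push (descent-++ (firstPassage⇒descent p) (pop (firstPassage-suffix p q)))
  ⋖-descent (there c) (pop q) = pop (⋖-descent c q)
  ⋖-descent (there c) (push q) = push (⋖-descent c q)

  ⋖-descent⁻ : w ⋖ w′ → Descent h w′ → Descent h w
  ⋖-descent⁻ (here p) (push q) with firstPassage-suffix p q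
  ... | pop q′ = pop (push (descent-++ (firstPassage⇒descent p) q′))
  ⋖-descent⁻ (there c) (pop q) = pop (⋖-descent⁻ c q)
  ⋖-descent⁻ (there c) (push q) = push (⋖-descent⁻ c q)

  ≼-descent⁻ : w ≼ w′ → Descent h w′ → Descent h w
  ≼-descent⁻ ε q = q
  ≼-descent⁻ (c ◅ cs) q = ⋖-descent⁻ c (≼-descent⁻ cs q)

  -- The ways in which a cover can end at u ++ pop ∷ r, where pop is a first passage to 0;
  -- in the case cross, it is this pop that moved.
  data CoverAtPop (u r : Word) : Word → Word → Set where
    left  : w ⋖ u → CoverAtPop u r w r
    right : w ⋖ r → CoverAtPop u r u w
    cross : Descent 0 z → u ≡ w ++ z → CoverAtPop u r w (z ++ r)

  -- A jumped prime that starts before the marked `pop` returns to its initial height before it. So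
  -- the `pop` that moved lies inside `u`, is the marked one, or lies in `z`.
  ⋖-pop⁻ : Descent e u → w ⋖ w′ → w′ ≡ u ++ pop ∷ z →
    ∃[ x ] ∃[ y ] (w ≡ x ++ pop ∷ y × Descent e x × CoverAtPop u z x y)
  ⋖-pop⁻ [] (there c) refl = [] , _ , refl , [] , right c
  ⋖-pop⁻ (pop p) (there c) eq with ∷-injective eq
  ... | refl , eq′ with ⋖-pop⁻ p c eq′
  ... | x , y , refl , q , left c′ = pop ∷ x , y , refl , pop q , left (there c′)
  ... | x , y , refl , q , right c′ = pop ∷ x , y , refl , pop q , right c′
  ... | x , y , refl , q , cross s refl = pop ∷ x , y , refl , pop q , cross s refl
  ⋖-pop⁻ (push p) (there c) eq with ∷-injective eq
  ... | refl , eq′ with ⋖-pop⁻ p c eq′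
  ... | x , y , refl , q , left c′ = push _ ∷ x , y , refl , push q , left (there c′)
  ... | x , y , refl , q , right c′ = push _ ∷ x , y , refl , push q , right c′
  ... | x , y , refl , q , cross s refl = push _ ∷ x , y , refl , push q , cross s refl
  ⋖-pop⁻ (push p) (here {u = b} f) eq with ∷-injective eq
  ... | refl , eq′ with firstPassage-prefix f p eq′
  -- The prime ends exactly at the marked `pop`, so this is the `pop` that moved.
  ... | [] , refl , [] , refl = [] , _ , refl , [] , cross (push b↓) (cong (push _ ∷_) (++-identityʳ b))
    where b↓ = descent-cast (sym (+-identityʳ _)) (firstPassage⇒descent f)
  ... | pop ∷ c , refl , pop q , refl =
    pop ∷ push _ ∷ b ++ c , _ , cong (λ t → pop ∷ push _ ∷ t) (sym (++-assoc b c _)) ,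
    pop (push (descent-++ (firstPassage⇒descent f) q)) , left (here f)

  -- No cover straddles the cut: a prime ending there would be followed by a `pop` at the head of
  -- `z`, which starts at height 0.
  ⋖-++⁻ : Descent h u → Descent 0 z → w ⋖ w′ → w′ ≡ u ++ z →
    (∃[ x ] (w ≡ x ++ z × x ⋖ u)) ⊎ (∃[ y ] (w ≡ u ++ y × y ⋖ z))
  ⋖-++⁻ [] _ c refl = inj₂ (_ , refl , c)
  ⋖-++⁻ (pop p) r (there c) eq with ∷-injective eq
  ... | refl , eq′ with ⋖-++⁻ p r c eq′
  ... | inj₁ (x , refl , c′) = inj₁ (pop ∷ x , refl , there c′)
  ... | inj₂ (y , refl , c′) = inj₂ (y , refl , c′)
  ⋖-++⁻ (push p) r (there c) eq with ∷-injective eq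
  ... | refl , eq′ with ⋖-++⁻ p r c eq′
  ... | inj₁ (x , refl , c′) = inj₁ (push _ ∷ x , refl , there c′)
  ... | inj₂ (y , refl , c′) = inj₂ (y , refl , c′)
  ⋖-++⁻ (push p) r (here {u = b} f) eq with ∷-injective eq
  ... | refl , eq′ with firstPassage-prefix f p eq′ | r
  ... | [] , refl , [] , refl | ()
  ... | pop ∷ c , refl , pop q , refl | _ =
    inj₁ (pop ∷ push _ ∷ b ++ c , cong (λ t → pop ∷ push _ ∷ t) (sym (++-assoc b c _)) , here f)

  -- `y` collects the primes that the marked `pop` jumps on its way up to `u ++ pop ∷ z`. Without
  -- this `pop` the chain falls apart into one up to `u` and one up to `z`. The induction traces the
  -- chain backwards from its upper end.
  ≼-pop⁻ : Descent e u → Descent 0 z → w ≼ u ++ pop ∷ z →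
    ∃[ x ] ∃[ y ] ∃[ z′ ] (w ≡ x ++ pop ∷ y ++ z′ × Descent e x × Descent 0 y × x ++ y ≼ u × z′ ≼ z)
  ≼-pop⁻ {u = u} {z = z} p q ε =
    u , [] , z , refl , p , [] , subst (_≼ u) (sym (++-identityʳ u)) ε , ε
  ≼-pop⁻ p q (c ◅ cs) with ≼-pop⁻ p q cs
  ... | x₁ , y₁ , z₁ , refl , px₁ , py₁ , s , s′ with ⋖-pop⁻ px₁ c refl
  ... | x , y , refl , px , left c₁ =
    x , y₁ , z₁ , refl , px , py₁ , ⋖-++ʳ y₁ c₁ ◅ s , s′
  -- The marked `pop` itself moved: `t` changes sides, and `x ++ y` stays the same word.
  ... | x , _ , refl , px , cross {z = t} pt refl =
    x , t ++ y₁ , z₁ , cong (λ r → x ++ pop ∷ r) (sym (++-assoc t y₁ z₁)) , px , descent-++ pt py₁ ,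
    subst (_≼ _) (++-assoc x t y₁) s , s′
  ... | x , y , refl , px , right c₁ with ⋖-++⁻ py₁ (≼-descent⁻ s′ q) c₁ refl
  ... | inj₁ (y₂ , refl , c₂) = x , y₂ , z₁ , refl , px , ⋖-descent⁻ c₂ py₁ , ⋖-++ˡ x c₂ ◅ s , s′
  ... | inj₂ (z₂ , refl , c₂) = x , y₁ , z₂ , refl , px , py₁ , s , c₂ ◅ s′

  -- Prime factors, and trees that encode intervals

  data Prime : Word → Set where
    prime : FirstPassage d w → Prime (push d ∷ w)

  concat-primes : ∀ {ws} → All Prime ws → Descent 0 (concat ws)
  concat-primes [] = []
  concat-primes (prime p ∷ ps) = push (descent-++ (firstPassage⇒descent p) (concat-primes ps))

  primes-unique : ∀ {us vs} → All Prime us → All Prime vs → concat us ≡ concat vs → us ≡ vs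
  primes-unique [] [] _ = refl
  primes-unique [] (prime _ ∷ _) ()
  primes-unique (prime _ ∷ _) [] ()
  primes-unique (prime p ∷ ps) (prime q ∷ qs) eq with ∷-injective eq
  ... | refl , eq₁ with firstPassage-unique p q eq₁
  ... | refl , eq₂ = cong (_ ∷_) (primes-unique ps qs eq₂)

  descent-factor : ∀ h w → Descent h w →
    ∃[ u ] ∃[ ws ] (w ≡ u ++ concat ws × FirstPassage h u × All Prime ws)
  descent-factor _ [] [] = [] , [] , refl , [] , []
  descent-factor (suc h) (pop ∷ w) (pop p) with descent-factor h w p
  ... | u , ws , refl , q , qs = pop ∷ u , ws , refl , pop q , qs
  descent-factor zero (push d ∷ w) (push p) with descent-factor d w (descent-cast (+-identityʳ d) p)
  ... | u , ws , refl , q , qs = [] , (push d ∷ u) ∷ ws , refl , [] , prime q ∷ qs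
  descent-factor (suc h) (push d ∷ w) (push p) with descent-factor (d + suc h) w p
  ... | u , ws , refl , q , qs = push d ∷ u , ws , refl , push q , qs

  pop-past-primes : ∀ {ws} → All Prime ws → ∀ z → pop ∷ concat ws ++ z ≼ concat ws ++ pop ∷ z
  pop-past-primes [] z = ε
  pop-past-primes {_ ∷ ws} (prime {d = d} {w = w} p ∷ ps) z =
    subst₂ _≼_ (cong (λ t → pop ∷ push d ∷ t) (sym (++-assoc w (concat ws) z)))
               (cong (push d ∷_) (sym (++-assoc w (concat ws) (pop ∷ z))))
               (here p ◅ ≼-++ˡ (push d ∷ w) (pop-past-primes ps z))

  -- deg t is the number of primes of lower t. In graft p j q, a new unit is added to the
  -- first push of p; it is popped at the very end in the upper word of p, and just before
  -- the last j primes in the lower one.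
  data Tree : Set
  deg : Tree → ℕ

  data Tree where
    leaf  : Tree
    lift  : Tree → Tree
    graft : (p : Tree) → Fin (deg p) → Tree → Tree

  deg leaf          = 0
  deg (lift t)      = suc (deg t)
  deg (graft p j q) = suc (toℕ j) + deg q

  -- `Fin (deg p)` forces `p` to differ from `leaf`, so the words raised in a graft begin with
  -- `push`; the second clause is a default value.
  raise : Word → Word
  raise (push d ∷ w) = push (suc d) ∷ w
  raise w            = w

  -- Raising keeps the first `deg p ∸ toℕ j` primes of `p` off the ground until the added `pop`, so
  -- they fuse into a single prime; the others are untouched.
  primes : Tree → List Word
  primes leaf          = []
  primes (lift t)      = [ push 0 ] ∷ primes t
  primes (graft p j q) = (raise (concat (take (deg p ∸ toℕ j) (primes p))) ++ [ pop ])
                       ∷ drop (deg p ∸ toℕ j) (primes p) ++ primes q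

  lower upper : Tree → Word
  lower t = concat (primes t)
  upper leaf          = []
  upper (lift t)      = push 0 ∷ upper t
  upper (graft p j q) = raise (upper p) ++ pop ∷ upper q

  record Sound (t : Tree) : Set where
    field
      length-primes : length (primes t) ≡ deg t
      all-prime     : All Prime (primes t)
      lower≼upper   : lower t ≼ upper t
      upper-descent : Descent 0 (upper t)
  open Sound

  -- A graft in plain words: `push root` begins both words of `p`, and `body` and `concat tails` are
  -- the parts of its lower word before and after the place of the new `pop`.
  record GraftView (p : Tree) (j : Fin (deg p)) (q : Tree) : Set where
    field
      root    : ℕ
      body top : Word
      tails   : List Word
      tails-prime  : All Prime tails
      tails-length : length tails ≡ toℕ j
      body-descent : Descent root body
      top-descent  : Descent root top
      below        : body ++ concat tails ≼ top
      lower-p      : lower p ≡ push root ∷ body ++ concat tails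
      upper-p      : upper p ≡ push root ∷ top
      primes-graft : primes (graft p j q) ≡ (push (suc root) ∷ body ++ [ pop ]) ∷ tails ++ primes q
      upper-graft  : upper (graft p j q) ≡ push (suc root) ∷ top ++ pop ∷ upper q

    lower-graft : lower (graft p j q) ≡ push (suc root) ∷ body ++ pop ∷ concat tails ++ lower q
    lower-graft = trans (cong concat primes-graft) (cong (push (suc root) ∷_)
      (trans (++-assoc body [ pop ] _) (cong (λ t → body ++ pop ∷ t) (sym (concat-++ tails (primes q))))))

  graftView : ∀ {p} → Sound p → ∀ j q → GraftView p j q
  -- Since `toℕ j < deg p`, at least one prime stays in front of the new `pop`; it contains the
  -- letter to be raised.
  graftView {p} sp j q = go (primes p) refl (deg p ∸ toℕ j) refl (m<n⇒0<n∸m (toℕ<n j)) (all-prime sp)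
    where
    go : ∀ ps → ps ≡ primes p → ∀ i → i ≡ deg p ∸ toℕ j → 0 < i → All Prime ps → GraftView p j q
    go [] eq i _ _ _ = contradiction (toℕ<n j)
      (subst (λ m → ¬ toℕ j < m) (trans (cong length eq) (length-primes sp)) λ ())
    go (_ ∷ ps) eq (suc i) eqi _ (prime {d = d} {w = w} f ∷ fs)
      with ≼-push (subst (_≼ upper p) (cong concat (sym eq)) (lower≼upper sp))
    ... | top , eqt , s = record
      { root = d ; body = w ++ concat (take i ps) ; top = top ; tails = drop i ps
      ; tails-prime = All.drop⁺ i fs
      ; tails-length = trans (length-drop i ps)
          (trans (cong₂ _∸_ (trans (cong length eq) (length-primes sp)) eqi)
          (m∸[m∸n]≡n (<⇒≤ (toℕ<n j))))
      ; body-descent = descent-cast (+-identityʳ d)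
          (descent-++ (firstPassage⇒descent f) (concat-primes (All.take⁺ i fs)))
      ; top-descent = descent-push⁻ (subst (Descent 0) eqt (upper-descent sp))
      ; below = subst (_≼ top) lem s
      ; lower-p = trans (cong concat (sym eq)) (cong (push d ∷_) lem)
      ; upper-p = eqt
      ; primes-graft = cong₂ (λ m qs → (raise (concat (take m qs)) ++ [ pop ]) ∷ drop m qs ++ primes q)
          (sym eqi) (sym eq)
      ; upper-graft = cong (λ t → raise t ++ pop ∷ upper q) eqt
      }
      where
      lem : w ++ concat ps ≡ (w ++ concat (take i ps)) ++ concat (drop i ps)
      lem = trans (cong (w ++_) (trans (cong concat (sym (take++drop≡id i ps)))
                                       (sym (concat-++ (take i ps) (drop i ps)))))
                  (sym (++-assoc w _ _))

  sound : ∀ t → Sound t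
  sound leaf = record { length-primes = refl ; all-prime = [] ; lower≼upper = ε ; upper-descent = [] }
  sound (lift t) = record
    { length-primes = cong suc (length-primes st)
    ; all-prime     = prime [] ∷ all-prime st
    ; lower≼upper   = ≼-++ˡ [ push 0 ] (lower≼upper st)
    ; upper-descent = push (upper-descent st)
    } where st = sound t
  sound (graft p j q) = record
    { length-primes = trans (cong length primes-graft) (cong suc (trans (length-++ tails)
        (cong₂ _+_ tails-length (length-primes sq))))
    ; all-prime     = subst (All Prime) (sym primes-graft)
        (prime (descent-∷ʳ-pop root body body-descent) ∷ All.++⁺ tails-prime (all-prime sq))
    -- Three moves: the new `pop` passes the last `toℕ j` primes of `p`; the chain of `p` runs
    -- behind its first letter, whose label does not matter there; then the chain of `q` runs.
    ; lower≼upper   = subst₂ _≼_ (sym lower-graft) (sym upper-graft)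
        (≼-++ˡ (push (suc root) ∷ body) (pop-past-primes tails-prime (lower q))
          ◅◅ ≼-++ˡ [ push (suc root) ] (subst (_≼ top ++ pop ∷ lower q) (++-assoc body (concat tails) _)
               (≼-++ʳ (pop ∷ lower q) below))
          ◅◅ ≼-++ˡ (push (suc root) ∷ top) (≼-++ˡ [ pop ] (lower≼upper sq)))
    ; upper-descent = subst (Descent 0) (sym upper-graft)
        (push (descent-cast (+-suc root 0)
          (descent-++ top-descent (pop (upper-descent sq)))))
    }
    where
    sq = sound q
    open GraftView (graftView (sound p) j q)

  take-length-++ : ∀ {A : Set} (xs : List A) {ys} → take (length xs) (xs ++ ys) ≡ xs
  take-length-++ [] = refl
  take-length-++ (x ∷ xs) = cong (x ∷_) (take-length-++ xs)

  drop-length-++ : ∀ {A : Set} (xs : List A) {ys} → drop (length xs) (xs ++ ys) ≡ ys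
  drop-length-++ [] = refl
  drop-length-++ (x ∷ xs) = drop-length-++ xs

  -- The index is `length vs`; hence every cut of `primes p` that leaves a prime on the left comes
  -- from a graft.
  graft-primes : ∀ {p us vs} q → 0 < length us → primes p ≡ us ++ vs →
    ∃[ j ] (primes (graft p j q) ≡ (raise (concat us) ++ [ pop ]) ∷ vs ++ primes q)
  graft-primes {p} {us} {vs} q 0<us eq = fromℕ< j<deg ,
    cong₂ (λ a b → (raise (concat a) ++ [ pop ]) ∷ b ++ primes q)
      (trans (cong₂ take index eq) (take-length-++ us))
      (trans (cong₂ drop index eq) (drop-length-++ us))
    where
    deg-p : deg p ≡ length us + length vs
    deg-p = trans (sym (length-primes (sound p))) (trans (cong length eq) (length-++ us))
    j<deg : length vs < deg p
    j<deg = subst (length vs <_) (sym deg-p) (m<n+m (length vs) 0<us)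
    index : deg p ∸ toℕ (fromℕ< j<deg) ≡ length us
    index = trans (cong₂ _∸_ deg-p (toℕ-fromℕ< j<deg)) (m+n∸n≡m (length us) (length vs))

  shorterˡ : ∀ (u z : Word) → suc (length u) ≤ length (u ++ pop ∷ z)
  shorterˡ u z = subst (suc (length u) ≤_) (sym (trans (length-++ u) (+-suc (length u) (length z))))
    (s≤s (m≤m+n (length u) (length z)))

  shorterʳ : ∀ (u z : Word) → length z ≤ length (u ++ pop ∷ z)
  shorterʳ u z = subst (length z ≤_) (sym (length-++ u)) (≤-trans (n≤1+n _) (m≤n+m _ (length u)))

  -- Surjectivity of the encoding. The length bound `n` drives the recursion, because the words for
  -- `p` and `q` are not subterms of the given ones.
  complete : ∀ n w w′ → length w′ ≤ n → Descent 0 w′ → w ≼ w′ → ∃[ t ] (lower t ≡ w × upper t ≡ w′)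
  complete n [] [] _ _ _ = leaf , refl , refl
  complete n (_ ∷ _) [] _ _ s with ≼-length s
  ... | ()
  complete n [] (_ ∷ _) _ _ s with ≼-length s
  ... | ()
  complete n (pop ∷ w) (push _ ∷ w′) _ p s with ≼-descent⁻ s p
  ... | ()
  complete (suc n) (push d ∷ w) (push d′ ∷ w′) (s≤s le) p s with ≼-push s
  complete (suc n) (push zero ∷ w) (push zero ∷ w′) (s≤s le) (push p) s | _ , refl , s′
    with complete n w w′ le p s′
  ... | t , refl , refl = lift t , refl , refl
  complete (suc n) (push (suc e) ∷ w) (push (suc e) ∷ w′) (s≤s le) p s | _ , refl , s′
    with descent-split e w′ (descent-push⁻ p)
  ... | u , z , refl , pu , pz with ≼-pop⁻ pu pz s′
  ... | x , y , z₁ , refl , px , py , s₁ , s₂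
    with complete n (push e ∷ x ++ y) (push e ∷ u) (≤-trans (shorterˡ u z) le)
           (descent-push pu) (≼-++ˡ [ push e ] s₁)
       | complete n z₁ z (≤-trans (shorterʳ u z) le) pz s₂
       | descent-factor 0 (push e ∷ x) (descent-push px) | descent-factor 0 y py
  -- A first passage from height 0 is empty, so `push e ∷ x` and `y` are products of primes; the
  -- former has at least one, as `graft-primes` requires.
  ... | t , lt , ut | q , refl , refl | [] , us@(_ ∷ _) , eq , [] , pus | [] , vs , refl , [] , pvs
    with graft-primes {t} {us} {vs} q (s≤s z≤n) (primes-unique (all-prime (sound t)) (All.++⁺ pus pvs)
           (trans lt (trans (cong (_++ concat vs) eq) (concat-++ us vs))))
  ... | j , eqp = graft t j q ,
    trans (cong concat eqp) (trans (cong (λ r → (raise r ++ [ pop ]) ++ concat (vs ++ primes q)) (sym eq))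
      (cong (push (suc e) ∷_) (trans (++-assoc x [ pop ] _)
        (cong (λ r → x ++ pop ∷ r) (sym (concat-++ vs (primes q))))))) ,
    cong (λ r → raise r ++ pop ∷ upper q) ut

  ++-injective : ∀ {a b c f : Word} → length b ≡ length f → a ++ b ≡ c ++ f → a ≡ c × b ≡ f
  ++-injective {[]} {b} {[]} le eq = refl , eq
  ++-injective {[]} {b} {_ ∷ c} {f} le refl =
    contradiction le (>⇒≢ (s≤s (subst (length f ≤_) (sym (length-++ c)) (m≤n+m _ (length c)))))
  ++-injective {_ ∷ a} {b} {[]} {f} le refl =
    contradiction le (<⇒≢ (s≤s (subst (length b ≤_) (sym (length-++ a)) (m≤n+m _ (length a)))))
  ++-injective {_ ∷ a} {b} {_ ∷ c} le eq with ∷-injective eq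
  ... | refl , eq₁ with ++-injective {a} {b} {c} le eq₁
  ... | refl , eq₂ = refl , eq₂

  graft-cong : ∀ {p p′ j j′ q q′} → p ≡ p′ → toℕ j ≡ toℕ j′ → q ≡ q′ → graft p j q ≡ graft p′ j′ q′
  graft-cong refl eq refl = cong (λ j → graft _ j _) (toℕ-injective eq)

  decode-injective : ∀ t t′ → lower t ≡ lower t′ → upper t ≡ upper t′ → t ≡ t′
  decode-injective leaf leaf _ _ = refl
  decode-injective leaf (graft p j q) _ eq with trans eq (GraftView.upper-graft (graftView (sound p) j q))
  ... | ()
  decode-injective (graft p j q) leaf _ eq with trans (sym eq) (GraftView.upper-graft (graftView (sound p) j q))
  ... | ()
  decode-injective (lift _) (graft p j q) _ eq with trans eq (GraftView.upper-graft (graftView (sound p) j q))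
  ... | ()
  decode-injective (graft p j q) (lift _) _ eq with trans (sym eq) (GraftView.upper-graft (graftView (sound p) j q))
  ... | ()
  decode-injective (lift t) (lift t′) eq eq′ = cong lift (decode-injective t t′ (∷-injectiveʳ eq) (∷-injectiveʳ eq′))
  decode-injective (graft p j q) (graft p′ j′ q′) eq eq′ = result
    where
    module G  = GraftView (graftView (sound p) j q)
    module G′ = GraftView (graftView (sound p′) j′ q′)
    lowers = ∷-injective (trans (sym G.lower-graft) (trans eq G′.lower-graft))
    uppers = ∷-injective (trans (sym G.upper-graft) (trans eq′ G′.upper-graft))
    roots : G′.root ≡ G.root
    roots with proj₁ lowers
    ... | r = sym (push-injective r)
      where
      push-injective : push (suc d) ≡ push (suc e) → d ≡ e
      push-injective refl = refl
    bodies = descent-pop-unique G.body-descent (descent-cast roots G′.body-descent) (proj₂ lowers)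
    tops = descent-pop-unique G.top-descent (descent-cast roots G′.top-descent) (proj₂ uppers)
    length-lower : ∀ t → length (lower t) ≡ length (upper t)
    length-lower t = ≼-length (lower≼upper (sound t))
    -- The cuts at the first passage fix `upper q`. The two words of an interval have equal length,
    -- so `lower q` is the suffix of that length.
    rests = ++-injective {concat G.tails} {lower q} {concat G′.tails} {lower q′}
      (trans (length-lower q) (trans (cong length (proj₂ tops)) (sym (length-lower q′)))) (proj₂ bodies)
    result : graft p j q ≡ graft p′ j′ q′
    result = graft-cong
      (decode-injective p p′
        (trans G.lower-p (trans
          (cong₂ _∷_ (cong push (sym roots)) (cong₂ _++_ (proj₁ bodies) (proj₁ rests))) (sym G′.lower-p)))
        (trans G.upper-p (trans (cong₂ _∷_ (cong push (sym roots)) (proj₁ tops)) (sym G′.upper-p))))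
      (trans (sym G.tails-length) (trans
        (cong length (primes-unique G.tails-prime G′.tails-prime (proj₁ rests))) G′.tails-length))
      (decode-injective q q′ (proj₂ rests) (proj₂ tops))

-- Translation between paths above `v` and words

module Paths where
  open import Defs
  open Words
  open import Data.Nat using (ℕ; zero; suc; _+_; _∸_; _≤_; _<_; z≤n; s≤s; s≤s⁻¹)
  open import Data.Nat.Properties
  open import Data.Product using (_×_; _,_; ∃-syntax; proj₁; proj₂)
  open import Data.Sum using (_⊎_; inj₁; inj₂)
  open import Data.List using ([]; _∷_; _++_; [_]; map; length; take; drop; replicate)
  open import Data.List.Properties
    using (++-assoc; ++-identityʳ; length-++; length-map; map-++; ∷-injective; ∷-injectiveʳ;
           take++drop≡id; length-drop; take-map)
  open import Relation.Nullary using (¬_; contradiction)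
  open import Relation.Binary.Construct.Closure.ReflexiveTransitive using (Star; ε; _◅_)
  open import Relation.Binary.PropositionalEquality
    using (_≡_; _≢_; refl; sym; trans; cong; cong₂; subst; subst₂)

  private variable
    d e g h : ℕ
    l : Letter
    u v w w′ x y z : Word

  step : Letter → Step
  step (push _) = N
  step pop      = E

  steps : Word → Path
  steps = map step

  base : Word → Path
  base []           = []
  base (push d ∷ w) = N ∷ replicate d E ++ base w
  base (pop ∷ w)    = base w

  -- `h` counts the E steps of the lower path before its first N, which no letter of the word
  -- carries.
  ground : ℕ → Word → Path
  ground h w = replicate h E ++ base w

  replicate-+ : ∀ m n {p : Path} → replicate (m + n) E ++ p ≡ replicate n E ++ replicate m E ++ p
  replicate-+ m zero {p} = cong (λ k → replicate k E ++ p) (+-identityʳ m)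
  replicate-+ m (suc n) {p} = trans (cong (λ k → replicate k E ++ p) (+-suc m n)) (cong (E ∷_) (replicate-+ m n))

  base≢E : ∀ w {p} → base w ≢ E ∷ p
  base≢E (pop ∷ w) eq = base≢E w eq

  ground-split : ∀ h g w {p} → ground g w ≡ replicate h E ++ p → ∃[ d ] (g ≡ d + h × p ≡ ground d w)
  ground-split zero g w eq = g , sym (+-identityʳ g) , sym eq
  ground-split (suc h) zero w eq = contradiction eq (base≢E w)
  ground-split (suc h) (suc g) w eq with ground-split h g w (∷-injectiveʳ eq)
  ... | d , refl , eq′ = d , sym (+-suc d h) , eq′

  ground-injective : ∀ h g w w′ → ground h w ≡ ground g w′ → h ≡ g × base w ≡ base w′
  ground-injective zero zero w w′ eq = refl , eq
  ground-injective zero (suc g) w w′ eq = contradiction eq (base≢E w)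
  ground-injective (suc h) zero w w′ eq = contradiction (sym eq) (base≢E w′)
  ground-injective (suc h) (suc g) w w′ eq with ground-injective h g w w′ (∷-injectiveʳ eq)
  ... | refl , eq′ = refl , eq′

  word-injective : ∀ w w′ → base w ≡ base w′ → steps w ≡ steps w′ → w ≡ w′
  word-injective [] [] _ _ = refl
  word-injective (pop ∷ w) (pop ∷ w′) eq eq′ = cong (pop ∷_) (word-injective w w′ eq (∷-injectiveʳ eq′))
  word-injective (push d ∷ w) (push d′ ∷ w′) eq eq′ with ground-injective d d′ w w′ (∷-injectiveʳ eq)
  ... | refl , eq₁ = cong (push d ∷_) (word-injective w w′ eq₁ (∷-injectiveʳ eq′))

  base-++ : ∀ u v → base (u ++ v) ≡ base u ++ base v
  base-++ [] v = refl
  base-++ (pop ∷ u) v = base-++ u v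
  base-++ (push d ∷ u) v = cong (N ∷_) (trans (cong (replicate d E ++_) (base-++ u v))
    (sym (++-assoc (replicate d E) _ _)))

  -- A cover keeps the order of the pushes, and only they contribute to `base`; so a chain stays
  -- over one lower path.
  ⋖-base : w ⋖ w′ → base w ≡ base w′
  ⋖-base (here {d = d} {u = u} {v = v} _) =
    cong (λ p → N ∷ replicate d E ++ p) (trans (base-++ u v) (sym (base-++ u (pop ∷ v))))
  ⋖-base (there {l = pop} c) = ⋖-base c
  ⋖-base (there {l = push d} c) = cong (λ p → N ∷ replicate d E ++ p) (⋖-base c)

  ≼-base : w ≼ w′ → base w ≡ base w′
  ≼-base ε = refl
  ≼-base (c ◅ cs) = trans (⋖-base c) (≼-base cs)

  descent-level : Descent h w → Descent g w → h ≡ g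
  descent-level [] [] = refl
  descent-level (pop p) (pop q) = cong suc (descent-level p q)
  descent-level (push {d = d} p) (push q) = +-cancelˡ-≡ d _ _ (descent-level p q)

  descent-suffix : ∀ u → Descent h (u ++ v) → ∃[ g ] Descent g v
  descent-suffix [] p = _ , p
  descent-suffix (pop ∷ u) (pop p) = descent-suffix u p
  descent-suffix (push _ ∷ u) (push p) = descent-suffix u p

  xmax-replicate : ∀ h p i → xmax (replicate h E ++ p) i ≡ h + xmax p i
  xmax-replicate zero p i = refl
  xmax-replicate (suc h) p i = cong suc (xmax-replicate h p i)

  xmax-base : ∀ w → xmax (base w) 0 ≡ 0
  xmax-base [] = refl
  xmax-base (push _ ∷ w) = refl
  xmax-base (pop ∷ w) = xmax-base w

  -- `xmax` adds up the E steps of the lower path in the rows reached so far, and the steps already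
  -- used are subtracted: this is the running height of the word.
  horiz-level : ∀ u → Descent h (u ++ v) → Descent g v → horiz (ground h (u ++ v)) (endpoint (steps u)) ≡ g
  horiz-level {h} {v} [] p q = trans (xmax-replicate h (base v) 0)
    (trans (cong (h +_) (xmax-base v)) (trans (+-identityʳ h) (descent-level p q)))
  horiz-level (pop ∷ u) (pop p) q = horiz-level u p q
  -- Row `suc n` of the old ground path ends where row `n` of `ground (d + h)` does: `push d` merges
  -- its `d` steps into the initial run.
  horiz-level {h} {v} (push d ∷ u) (push p) q = trans (cong (_∸ #E (steps u))
    (trans (xmax-replicate h _ (suc n)) (trans (cong (h +_) (xmax-replicate d _ n))
      (trans (sym (+-assoc h d _)) (trans (cong (_+ xmax (base (u ++ v)) n) (+-comm h d))
        (sym (xmax-replicate (d + h) _ n)))))))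
    (horiz-level u p q)
    where n = #N (steps u)

  length-#E+#N : ∀ p → length p ≡ #E p + #N p
  length-#E+#N [] = refl
  length-#E+#N (E ∷ p) = cong suc (length-#E+#N p)
  length-#E+#N (N ∷ p) = trans (cong suc (length-#E+#N p)) (sym (+-suc (#E p) (#N p)))

  #E-insert-N : ∀ h p → #E (replicate h E ++ N ∷ p) ≡ #E (replicate h E ++ p)
  #E-insert-N zero p = refl
  #E-insert-N (suc h) p = cong suc (#E-insert-N h p)

  #N-insert-N : ∀ h p → #N (replicate h E ++ N ∷ p) ≡ suc (#N (replicate h E ++ p))
  #N-insert-N zero p = refl
  #N-insert-N (suc h) p = #N-insert-N h p

  #N-take-insert-N : ∀ h p k → #N (take (suc k) (replicate h E ++ N ∷ p)) ≤ suc (#N (take k (replicate h E ++ p)))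
  #N-take-insert-N zero p k = ≤-refl
  #N-take-insert-N (suc h) p zero = z≤n
  #N-take-insert-N (suc h) p (suc k) = #N-take-insert-N h p k

  -- The left case is a prefix that stops before the deleted N.
  #N-take-delete-N : ∀ h p k → #N (take k (replicate h E ++ p)) ≡ 0 ⊎
    suc (#N (take k (replicate h E ++ p))) ≤ #N (take (suc k) (replicate h E ++ N ∷ p))
  #N-take-delete-N zero p k = inj₂ ≤-refl
  #N-take-delete-N (suc h) p zero = inj₁ refl
  #N-take-delete-N (suc h) p (suc k) = #N-take-delete-N h p k

  descent-endpoint : Descent h w → endpoint (steps w) ≡ endpoint (ground h w)
  descent-endpoint [] = refl
  descent-endpoint (pop p) with descent-endpoint p
  ... | eq = cong₂ _,_ (cong suc (cong proj₁ eq)) (cong proj₂ eq)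
  descent-endpoint {h} (push {d = d} {w = w} p) with trans (descent-endpoint p) (cong endpoint (replicate-+ d h))
  ... | eq = cong₂ _,_ (trans (cong proj₁ eq) (sym (#E-insert-N h _)))
                       (trans (cong suc (cong proj₂ eq)) (sym (#N-insert-N h _)))

  descent-above : Descent h w → ∀ k → #N (take k (ground h w)) ≤ #N (take k (steps w))
  descent-above [] k = ≤-refl
  descent-above (pop p) zero = z≤n
  descent-above (pop p) (suc k) = descent-above p k
  descent-above (push p) zero = z≤n
  descent-above {h} (push {d = d} p) (suc k) = ≤-trans (#N-take-insert-N h _ k)
    (s≤s (subst (λ q → #N (take k q) ≤ _) (replicate-+ d h) (descent-above p k)))

  descent⇒tam : Descent h w → Tam (ground h w) (steps w)
  descent⇒tam {h} {w} p = eq , trans (length-#E+#N (steps w))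
    (trans (cong₂ _+_ (cong proj₁ eq) (cong proj₂ eq)) (sym (length-#E+#N (ground h w)))) , descent-above p
    where eq = descent-endpoint p

  first-N : ∀ p → 0 < #N p → ∃[ h ] ∃[ q ] (p ≡ replicate h E ++ N ∷ q)
  first-N (N ∷ p) _ = 0 , p , refl
  first-N (E ∷ p) lt with first-N p lt
  ... | h , q , refl = suc h , q , refl

  -- A leading N of `q` is matched with the first N of `p`. Once both are deleted, the E runs of `p`
  -- around that N merge, and `ground-split` takes off `h` again to find the label `d`.
  tam⇒descent : ∀ p q → Tam p q → ∃[ h ] ∃[ w ] (Descent h w × ground h w ≡ p × steps w ≡ q)
  tam⇒descent [] [] _ = 0 , [] , [] , refl , refl
  tam⇒descent (_ ∷ _) [] (_ , () , _)
  tam⇒descent [] (E ∷ q) (_ , () , _)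
  tam⇒descent (N ∷ p) (E ∷ q) (_ , _ , le) with le 1
  ... | ()
  tam⇒descent (E ∷ p) (E ∷ q) (eq , len , le)
    with tam⇒descent p q (cong₂ _,_ (suc-injective (cong proj₁ eq)) (cong proj₂ eq) ,
                          suc-injective len , λ k → le (suc k))
  ... | h , w , r , refl , refl = suc h , pop ∷ w , pop r , refl , refl
  tam⇒descent p (N ∷ q) (eq , len , le) with first-N p (subst (0 <_) (cong proj₂ eq) (s≤s z≤n))
  ... | h , p′ , refl
    with tam⇒descent (replicate h E ++ p′) q
           (eq′ , trans (length-#E+#N q) (trans (cong₂ _+_ (cong proj₁ eq′) (cong proj₂ eq′))
                                                (sym (length-#E+#N (replicate h E ++ p′)))) , le′)
    where
    eq′ : endpoint q ≡ endpoint (replicate h E ++ p′)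
    eq′ = cong₂ _,_ (trans (cong proj₁ eq) (#E-insert-N h p′))
                    (suc-injective (trans (cong proj₂ eq) (#N-insert-N h p′)))
    le′ : ∀ k → #N (take k (replicate h E ++ p′)) ≤ #N (take k q)
    le′ k with #N-take-delete-N h p′ k
    ... | inj₁ z = subst (_≤ _) (sym z) z≤n
    ... | inj₂ lt = s≤s⁻¹ (≤-trans lt (le (suc k)))
  ... | g , w , r , eqg , refl with ground-split h g w eqg
  ... | d , refl , refl = h , push d ∷ w , push r , refl , refl

  steps-++⁻ : ∀ w p {q} → steps w ≡ p ++ q → ∃[ u ] ∃[ v ] (w ≡ u ++ v × steps u ≡ p × steps v ≡ q)
  steps-++⁻ w [] eq = [] , w , refl , refl , eq
  steps-++⁻ (l ∷ w) (s ∷ p) eq with ∷-injective eq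
  ... | refl , eq′ with steps-++⁻ w p eq′
  ... | u , v , refl , refl , refl = l ∷ u , v , refl , refl , refl

  -- Heights fall by one at a time, so before passing below `g` the word would meet `g` at an inner
  -- point, which the last hypothesis forbids.
  avoids⇒firstPassage : ∀ d u → Descent (d + g) (u ++ v) → Descent g v →
    (∀ x l y → u ≡ x ++ l ∷ y → ¬ Descent g (l ∷ y ++ v)) → FirstPassage d u
  avoids⇒firstPassage {g} d [] p q _ with +-cancelʳ-≡ g d 0 (descent-level p q)
  ... | refl = []
  avoids⇒firstPassage zero (l ∷ u) p q avoid = contradiction p (avoid [] l u refl)
  avoids⇒firstPassage (suc d) (pop ∷ u) (pop p) q avoid =
    pop (avoids⇒firstPassage d u p q λ x l y eq → avoid (pop ∷ x) l y (cong (pop ∷_) eq))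
  avoids⇒firstPassage {g} (suc d) (push e ∷ u) (push p) q avoid =
    push (avoids⇒firstPassage (e + suc d) u (descent-cast (sym (+-assoc e (suc d) g)) p) q
      λ x l y eq → avoid (push e ∷ x) l y (cong (push e ∷_) eq))

  firstPassage-suffix⁺ : ∀ x {y} → FirstPassage d (x ++ l ∷ y) → ∃[ m ] FirstPassage (suc m) (l ∷ y)
  firstPassage-suffix⁺ [] (pop p) = _ , pop p
  firstPassage-suffix⁺ [] (push p) = _ , push p
  firstPassage-suffix⁺ (pop ∷ x) (pop p) = firstPassage-suffix⁺ x p
  firstPassage-suffix⁺ (push _ ∷ x) (push p) = firstPassage-suffix⁺ x p

  -- Inside a first passage the height stays strictly above its final value.
  firstPassage⇒avoids : ∀ x {y} → FirstPassage d (x ++ l ∷ y) → Descent g v → ¬ Descent g (l ∷ y ++ v)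
  firstPassage⇒avoids {g = g} x p q r with firstPassage-suffix⁺ x p
  ... | m , p′ = m+1+n≢n m (trans (+-suc m g) (descent-level (descent-++ (firstPassage⇒descent p′) q) r))

  horiz-at : ∀ u {p} → Descent h w → w ≡ u ++ v → Descent g v → steps u ≡ p →
    horiz (ground h w) (endpoint p) ≡ g
  horiz-at u r refl s refl = horiz-level u r s

  -- Evaluates `horiz` at the points named by `FirstSameHoriz`: the valley after `a` and `pop`, and
  -- the points after `push d` and a prefix of `b`.
  module AtValley (a : Word) (d : ℕ) (b c : Word) {h : ℕ} (r : Descent h (a ++ pop ∷ push d ∷ b ++ c)) where
    v₀ : Path
    v₀ = ground h (a ++ pop ∷ push d ∷ b ++ c)

    horiz-start : Descent g (push d ∷ b ++ c) → horiz v₀ (endpoint (steps a ++ [ E ])) ≡ g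
    horiz-start s = horiz-at (a ++ [ pop ]) r (sym (++-assoc a [ pop ] _)) s (map-++ step a [ pop ])

    horiz-after : ∀ u v → b ≡ u ++ v → Descent g (v ++ c) →
      horiz v₀ (endpoint ((steps a ++ [ E ]) ++ N ∷ steps u)) ≡ g
    horiz-after u v eq s = horiz-at ((a ++ [ pop ]) ++ push d ∷ u) r
      (trans (cong (λ t → a ++ pop ∷ push d ∷ t ++ c) eq)
        (sym (trans (cong (_++ (v ++ c)) (++-assoc a [ pop ] _))
          (trans (++-assoc a _ _) (cong (λ t → a ++ pop ∷ push d ∷ t) (sym (++-assoc u v c)))))))
      s
      (trans (map-++ step (a ++ [ pop ]) _) (cong (_++ N ∷ steps u) (map-++ step a [ pop ])))

    horiz-end : Descent g c → horiz v₀ (endpoint ((steps a ++ [ E ]) ++ N ∷ steps b)) ≡ g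
    horiz-end = horiz-after b [] (sym (++-identityʳ b))

  cover⇒⋖ : ∀ {p p′} → Descent h w → steps w ≡ p → Cover (ground h w) p p′ → ∃[ w′ ] (w ⋖ w′ × steps w′ ≡ p′)
  cover⇒⋖ {w = w} r eq (cover A B′ C _ (same , avoid)) with steps-++⁻ w A eq
  ... | a , pop ∷ push d ∷ bc , refl , refl , eq₁ with steps-++⁻ bc B′ (∷-injectiveʳ (∷-injectiveʳ eq₁))
  ... | b , c , refl , refl , refl with descent-suffix a r
  ... | _ , pop (push q) with descent-suffix b q
  ... | _ , qc = a ++ push d ∷ b ++ pop ∷ c , ⋖-++ˡ a (here fp) ,
    trans (map-++ step a _) (cong (λ t → steps a ++ N ∷ t) (map-++ step b _))
    where
    open AtValley a d b c r
    start = horiz-start (push q)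
    fp : FirstPassage d b
    fp = avoids⇒firstPassage d b q (subst (λ g → Descent g c) (trans (sym (horiz-end qc)) (trans same start)) qc)
      -- A return after the prefix `x` of `b` would be an inner point with index `suc (length x)`;
      -- the extra one is the leading N.
      λ { x l y refl s → avoid (suc (length x)) (s≤s z≤n)
            (s≤s (subst (length x <_) (sym (trans (length-map step (x ++ l ∷ y)) (length-++ x)))
              (m<m+n (length x) (s≤s z≤n))))
            (trans (cong (λ t → horiz v₀ (endpoint ((steps a ++ [ E ]) ++ N ∷ t)))
                     (trans (cong₂ take (sym (length-map step x)) (map-++ step x (l ∷ y))) (take-length-++ (steps x))))
              (trans (horiz-after x (l ∷ y) refl s) (sym start))) }

  ⋖-split : w ⋖ w′ → ∃[ a ] ∃[ d ] ∃[ b ] ∃[ c ]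
    (FirstPassage d b × w ≡ a ++ pop ∷ push d ∷ b ++ c × w′ ≡ a ++ push d ∷ b ++ pop ∷ c)
  ⋖-split (here p) = [] , _ , _ , _ , p , refl , refl
  ⋖-split (there {l = l} s) with ⋖-split s
  ... | a , d , b , c , p , refl , refl = l ∷ a , d , b , c , p , refl , refl

  ⋖⇒cover : Descent h w → w ⋖ w′ → Cover (ground h w) (steps w) (steps w′)
  ⋖⇒cover {h} r s with ⋖-split s
  ... | a , d , b , c , p , refl , refl with descent-suffix a r
  ... | suc g , pop (push q) = subst₂ (Cover _) (sym eq)
          (sym (trans (map-++ step a _) (cong (λ t → steps a ++ N ∷ t) (map-++ step b _))))
          (cover (steps a) (steps b) (steps c)
            (subst (Tam _) eq (descent⇒tam r)) (trans (horiz-end qc) (sym start) , avoid))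
    where
    w₀ = a ++ pop ∷ push d ∷ b ++ c
    eq : steps w₀ ≡ steps a ++ E ∷ (N ∷ steps b) ++ steps c
    eq = trans (map-++ step a _) (cong (λ t → steps a ++ E ∷ N ∷ t) (map-++ step b c))
    qc : Descent g c
    qc = firstPassage-suffix p q
    open AtValley a d b c r
    start = horiz-start (push q)
    avoid : ∀ k → 0 < k → k < suc (length (steps b)) →
            horiz v₀ (endpoint ((steps a ++ [ E ]) ++ take k (N ∷ steps b)))
            ≢ horiz v₀ (endpoint (steps a ++ [ E ]))
    -- The point with index `suc k` lies before the suffix `drop k b`, which is non-empty by `lt`.
    avoid (suc k) _ (s≤s lt) same with drop k b in eqd
    ... | [] = contradiction (trans (sym (length-drop k b)) (cong length eqd))
                 (m>n⇒m∸n≢0 (subst (k <_) (length-map step b) lt))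
    ... | l ∷ y = firstPassage⇒avoids (take k b) (subst (FirstPassage d) split p) qc
                    (subst (λ g → Descent g (l ∷ y ++ c)) (trans (sym lev) (trans same start)) (proj₂ suf))
      where
      split : b ≡ take k b ++ l ∷ y
      split = trans (sym (take++drop≡id k b)) (cong (take k b ++_) eqd)
      suf = descent-suffix (take k b) (subst (Descent (d + g))
              (trans (cong (_++ c) split) (++-assoc (take k b) (l ∷ y) c)) q)
      lev : horiz v₀ (endpoint ((steps a ++ [ E ]) ++ N ∷ take k (steps b))) ≡ proj₁ suf
      lev = trans (cong (λ t → horiz v₀ (endpoint ((steps a ++ [ E ]) ++ N ∷ t))) (take-map {f = step} k b))
              (horiz-after (take k b) (l ∷ y) split (proj₂ suf))

  ≤⇒≼ : ∀ {p q v} → Descent h w → ground h w ≡ v → steps w ≡ p → p ≤[ v ] q →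
    ∃[ w′ ] (w ≼ w′ × Descent h w′ × steps w′ ≡ q)
  ≤⇒≼ r _ eq ε = _ , ε , r , eq
  ≤⇒≼ {h} r refl eq (c ◅ cs) with cover⇒⋖ r eq c
  ... | w₁ , s , eq₁ with ≤⇒≼ (⋖-descent s r) (cong (replicate h E ++_) (sym (⋖-base s))) eq₁ cs
  ... | w₂ , s′ , r₂ , eq₂ = w₂ , s ◅ s′ , r₂ , eq₂

  ≼⇒≤ : Descent h w → w ≼ w′ → steps w ≤[ ground h w ] steps w′
  ≼⇒≤ r ε = ε
  ≼⇒≤ {h} r (c ◅ cs) = ⋖⇒cover r c ◅
    subst (λ b → Star (Cover (replicate h E ++ b)) _ _) (sym (⋖-base c)) (≼⇒≤ (⋖-descent c r) cs)

  ≼⇒interval : Descent h w′ → w ≼ w′ → Interval (ground h w′) (steps w , steps w′)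
  ≼⇒interval {h} {w′} {w} r s =
    subst (λ b → Tam b (steps w)) eq (descent⇒tam r′) , descent⇒tam r ,
    subst (λ b → steps w ≤[ b ] steps w′) eq (≼⇒≤ r′ s)
    where
    r′ = ≼-descent⁻ s r
    eq : ground h w ≡ ground h w′
    eq = cong (replicate h E ++_) (≼-base s)

  interval⇒≼ : ∀ {v p q} → Interval v (p , q) →
    ∃[ h ] ∃[ w ] ∃[ w′ ] (Descent h w′ × w ≼ w′ × ground h w′ ≡ v × steps w ≡ p × steps w′ ≡ q)
  interval⇒≼ {v} {p} (tp , _ , s) with tam⇒descent v p tp
  ... | h , w , r , refl , refl with ≤⇒≼ r refl refl s
  ... | w′ , s′ , r′ , refl = h , w , w′ , r′ , s′ , cong (replicate h E ++_) (sym (≼-base s′)) , refl , refl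

-- Tree sums and the catalytic equation

module GeneratingFunctions where
  open Words
  open import Level using (0ℓ)
  open import Algebra.Bundles using (CommutativeSemiring)
  open import Algebra.Structures.Biased using (isCommutativeSemiringˡ)
  open import Data.Nat using (ℕ; zero; suc; _∸_; _≤_; _<_; z≤n; s≤s) renaming (_+_ to _+ℕ_)
  import Data.Nat.Properties as ℕ
  open import Data.Fin using (Fin; toℕ; zero; suc)
  open import Data.Product using (_×_; _,_; proj₁; proj₂)
  open import Data.List using (List; []; _∷_; _++_; map; concatMap; allFin; tabulate)
  open import Function using (_∘_)
  open import Relation.Binary.Structures using (IsEquivalence)
  open import Relation.Binary.PropositionalEquality as ≡ using ()

  size : Tree → ℕ
  size leaf          = 0
  size (lift t)      = suc (size t)
  size (graft p j q) = suc (size p +ℕ size q)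

  grafts : List Tree → List Tree → List Tree
  grafts ps qs = concatMap (λ p → concatMap (λ j → map (graft p j) qs) (allFin (deg p))) ps

  -- The trees of height below h: these include all trees of size below h, and larger ones
  -- vanish in a semiring where τ ^ h ≈ 0#.
  gen : ℕ → List Tree
  gen zero    = []
  gen (suc h) = leaf ∷ map lift (gen h) ++ grafts (gen h) (gen h)

  module ListSum (R : CommutativeSemiring 0ℓ 0ℓ) where
    open CommutativeSemiring R
    open import Relation.Binary.Reasoning.Setoid setoid
    open import Algebra.Properties.Semiring.Exp semiring using (_^_; ^-homo-*)
    open import Algebra.Solver.Ring.NaturalCoefficients.Default R

    private variable
      A B : Set

    Σ : List A → (A → Carrier) → Carrier
    Σ []       f = 0#
    Σ (a ∷ as) f = f a + Σ as f

    Σ-++ : ∀ as {bs} (f : A → Carrier) → Σ (as ++ bs) f ≈ Σ as f + Σ bs f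
    Σ-++ [] f = sym (+-identityˡ _)
    Σ-++ (a ∷ as) f = trans (+-congˡ (Σ-++ as f)) (sym (+-assoc _ _ _))

    Σ-map : ∀ (g : A → B) as f → Σ (map g as) f ≈ Σ as (f ∘ g)
    Σ-map g [] f = refl
    Σ-map g (a ∷ as) f = +-congˡ (Σ-map g as f)

    Σ-concatMap : ∀ (g : A → List B) as f → Σ (concatMap g as) f ≈ Σ as (λ a → Σ (g a) f)
    Σ-concatMap g [] f = refl
    Σ-concatMap g (a ∷ as) f = trans (Σ-++ (g a) f) (+-congˡ (Σ-concatMap g as f))

    Σ-cong : ∀ as {f g : A → Carrier} → (∀ a → f a ≈ g a) → Σ as f ≈ Σ as g
    Σ-cong [] eq = refl
    Σ-cong (a ∷ as) eq = +-cong (eq a) (Σ-cong as eq)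

    Σ-distribˡ : ∀ c as (f : A → Carrier) → c * Σ as f ≈ Σ as (λ a → c * f a)
    Σ-distribˡ c [] f = zeroʳ c
    Σ-distribˡ c (a ∷ as) f = trans (distribˡ c _ _) (+-congˡ (Σ-distribˡ c as f))

    Σ-+ : ∀ as (f g : A → Carrier) → Σ as (λ a → f a + g a) ≈ Σ as f + Σ as g
    Σ-+ [] f g = sym (+-identityˡ 0#)
    Σ-+ (a ∷ as) f g = trans (+-congˡ (Σ-+ as f g))
      (solve 4 (λ p q r s → (p :+ q) :+ (r :+ s) := (p :+ r) :+ (q :+ s)) refl (f a) (g a) _ _)

    Σ-tabulate : ∀ n (f : Fin n → A) g → Σ (tabulate f) g ≈ Σ (allFin n) (g ∘ f)
    Σ-tabulate zero f g = refl
    Σ-tabulate (suc n) f g = +-congˡ (trans (Σ-tabulate n (f ∘ suc) g) (sym (Σ-tabulate n suc (g ∘ f))))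

    -- Stands for `(xⁿ - 1) / (x - 1)` in a semiring.
    geometric : Carrier → ℕ → Carrier
    geometric x n = Σ (allFin n) (λ j → x ^ toℕ j)

    geometric-suc : ∀ x n → geometric x (suc n) ≈ 1# + x * geometric x n
    geometric-suc x n = +-congˡ (trans (Σ-tabulate n suc _) (sym (Σ-distribˡ x (allFin n) _)))

    geometric-sum : ∀ x n → x * geometric x n + 1# ≈ geometric x n + x ^ n
    geometric-sum x zero = trans (+-congʳ (zeroʳ x)) refl
    geometric-sum x (suc n) = begin
      x * geometric x (suc n) + 1#            ≈⟨ +-congʳ (*-congˡ (geometric-suc x n)) ⟩
      x * (1# + x * geometric x n) + 1#
        ≈⟨ solve 2 (λ x g → x :* (con 1 :+ x :* g) :+ con 1 := x :* (x :* g :+ con 1) :+ con 1) refl x _ ⟩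
      x * (x * geometric x n + 1#) + 1#       ≈⟨ +-congʳ (*-congˡ (geometric-sum x n)) ⟩
      x * (geometric x n + x ^ n) + 1#
        ≈⟨ solve 3 (λ x g p → x :* (g :+ p) :+ con 1 := (con 1 :+ x :* g) :+ x :* p) refl x _ _ ⟩
      (1# + x * geometric x n) + x * x ^ n    ≈⟨ +-congʳ (geometric-suc x n) ⟨
      geometric x (suc n) + x ^ suc n         ∎

  module TreeSum (R : CommutativeSemiring 0ℓ 0ℓ) (τ : CommutativeSemiring.Carrier R) where
    open CommutativeSemiring R
    open ListSum R
    open import Relation.Binary.Reasoning.Setoid setoid
    open import Algebra.Properties.Semiring.Exp semiring using (_^_; ^-homo-*)
    open import Algebra.Solver.Ring.NaturalCoefficients.Default R

    weigh : (Tree → Carrier) → Tree → Carrier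
    weigh g t = τ ^ size t * g t

    S : ℕ → (Tree → Carrier) → Carrier
    S h g = Σ (gen h) (weigh g)

    S-cong : ∀ h {f g} → (∀ t → f t ≈ g t) → S h f ≈ S h g
    S-cong h eq = Σ-cong (gen h) (λ t → *-congˡ (eq t))

    S-distribˡ : ∀ h c f → c * S h f ≈ S h (λ t → c * f t)
    S-distribˡ h c f = trans (Σ-distribˡ c (gen h) _) (Σ-cong (gen h) λ t →
      solve 3 (λ c p f → c :* (p :* f) := p :* (c :* f)) refl c _ _)

    S-+ : ∀ h f g → S h (λ t → f t + g t) ≈ S h f + S h g
    S-+ h f g = trans (Σ-cong (gen h) λ t → distribˡ _ _ _) (Σ-+ (gen h) _ _)

    S-suc : ∀ h g → S (suc h) g ≈
      g leaf + τ * (S h (g ∘ lift) + S h (λ p → Σ (allFin (deg p)) (λ j → S h (g ∘ graft p j))))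
    S-suc h g = begin
      1# * g leaf + Σ (map lift (gen h) ++ grafts (gen h) (gen h)) (weigh g)
        ≈⟨ +-cong (*-identityˡ _) (Σ-++ (map lift (gen h)) _) ⟩
      g leaf + (Σ (map lift (gen h)) (weigh g) + Σ (grafts (gen h) (gen h)) (weigh g))
        ≈⟨ +-congˡ (+-cong lifts grafted) ⟩
      g leaf + (τ * S h (g ∘ lift) + τ * S h (λ p → Σ (allFin (deg p)) (λ j → S h (g ∘ graft p j))))
        ≈⟨ +-congˡ (distribˡ _ _ _) ⟨
      g leaf + τ * (S h (g ∘ lift) + S h (λ p → Σ (allFin (deg p)) (λ j → S h (g ∘ graft p j)))) ∎
      where
      lifts : Σ (map lift (gen h)) (weigh g) ≈ τ * S h (g ∘ lift)
      lifts = trans (Σ-map lift (gen h) _) (sym (trans (Σ-distribˡ τ (gen h) _)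
        (Σ-cong (gen h) λ t → sym (*-assoc _ _ _))))
      grafted₁ : ∀ p j → Σ (map (graft p j) (gen h)) (weigh g) ≈ τ * (τ ^ size p * S h (g ∘ graft p j))
      grafted₁ p j = trans (Σ-map (graft p j) (gen h) _) (sym (trans (*-congˡ (Σ-distribˡ _ (gen h) _))
        (trans (Σ-distribˡ τ (gen h) _)
        (Σ-cong (gen h) λ q → trans
          (solve 4 (λ a b c d → a :* (b :* (c :* d)) := (a :* (b :* c)) :* d) refl τ (τ ^ size p) (τ ^ size q) _)
          (*-congʳ (*-congˡ (sym (^-homo-* τ (size p) (size q)))))))))
      grafted : Σ (grafts (gen h) (gen h)) (weigh g) ≈ τ * S h (λ p → Σ (allFin (deg p)) (λ j → S h (g ∘ graft p j)))
      grafted = begin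
        Σ (grafts (gen h) (gen h)) (weigh g)
          ≈⟨ Σ-concatMap _ (gen h) _ ⟩
        Σ (gen h) (λ p → Σ (concatMap (λ j → map (graft p j) (gen h)) (allFin (deg p))) (weigh g))
          ≈⟨ Σ-cong (gen h) (λ p → trans (Σ-concatMap _ (allFin (deg p)) _) (Σ-cong (allFin (deg p)) (grafted₁ p))) ⟩
        Σ (gen h) (λ p → Σ (allFin (deg p)) (λ j → τ * (τ ^ size p * S h (g ∘ graft p j))))
          ≈⟨ Σ-cong (gen h) (λ p → trans (sym (Σ-distribˡ τ (allFin (deg p)) _))
                                     (*-congˡ (sym (Σ-distribˡ _ (allFin (deg p)) _)))) ⟩
        Σ (gen h) (λ p → τ * (τ ^ size p * Σ (allFin (deg p)) (λ j → S h (g ∘ graft p j))))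
          ≈⟨ Σ-distribˡ τ (gen h) _ ⟨
        τ * S h (λ p → Σ (allFin (deg p)) (λ j → S h (g ∘ graft p j))) ∎

    Σ-scaled : ∀ {A : Set} c (as : List A) {f g} → (∀ a → c * f a ≈ c * g a) → c * Σ as f ≈ c * Σ as g
    Σ-scaled c as eq = trans (Σ-distribˡ c as _) (trans (Σ-cong as eq) (sym (Σ-distribˡ c as _)))

    S-scaled : ∀ c h {f g} → (∀ t → c * f t ≈ c * g t) → c * S h f ≈ c * S h g
    S-scaled c h eq = trans (S-distribˡ h c _) (trans (S-cong h eq) (sym (S-distribˡ h c _)))

    -- Every level of a tree contributes one `τ`, which moves into the prefactor. When height 0 is
    -- reached the prefactor has become `τ ^ (i + h)` and vanishes.
    S-stable : ∀ h i g → τ ^ (i +ℕ h) ≈ 0# → τ ^ i * S (suc h) g ≈ τ ^ i * S h g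
    S-stable zero i g eq = trans (*-congʳ τⁱ≈0) (trans (zeroˡ _) (sym (trans (*-congʳ τⁱ≈0) (zeroˡ _))))
      where
      τⁱ≈0 : τ ^ i ≈ 0#
      τⁱ≈0 = trans (reflexive (≡.cong (τ ^_) (≡.sym (ℕ.+-identityʳ i)))) eq
    S-stable (suc h) i g eq = begin
      τ ^ i * S (suc (suc h)) g
        ≈⟨ *-congˡ (S-suc (suc h) g) ⟩
      τ ^ i * (g leaf + τ * (S (suc h) (g ∘ lift)
                             + S (suc h) (λ p → Σ (allFin (deg p)) (λ j → S (suc h) (g ∘ graft p j)))))
        ≈⟨ expand _ _ _ ⟩
      τ ^ i * g leaf + (c * S (suc h) (g ∘ lift)
                        + c * S (suc h) (λ p → Σ (allFin (deg p)) (λ j → S (suc h) (g ∘ graft p j))))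
        -- The graft term nests two sums of height `suc h`: the outer one is lowered first, then the
        -- inner one.
        ≈⟨ +-congˡ (+-cong (ih _) (trans (ih _) (S-scaled c h λ p → Σ-scaled c (allFin (deg p)) λ j → ih _))) ⟩
      τ ^ i * g leaf + (c * S h (g ∘ lift) + c * S h (λ p → Σ (allFin (deg p)) (λ j → S h (g ∘ graft p j))))
        ≈⟨ expand _ _ _ ⟨
      τ ^ i * (g leaf + τ * (S h (g ∘ lift) + S h (λ p → Σ (allFin (deg p)) (λ j → S h (g ∘ graft p j)))))
        ≈⟨ *-congˡ (S-suc h g) ⟨
      τ ^ i * S (suc h) g ∎
      where
      c = τ ^ suc i
      expand : ∀ a b d → τ ^ i * (a + τ * (b + d)) ≈ τ ^ i * a + (c * b + c * d)
      expand a b d = solve 5 (λ t p a b d →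
        p :* (a :+ t :* (b :+ d)) := p :* a :+ (t :* p :* b :+ t :* p :* d)) refl τ (τ ^ i) a b d
      ih : ∀ f → c * S (suc h) f ≈ c * S h f
      ih f = S-stable h (suc i) f (trans (reflexive (≡.cong (τ ^_) (≡.sym (ℕ.+-suc i h)))) eq)

    total : ℕ → Carrier
    total h = S h (λ _ → 1#)

    module _ (x : Carrier) where
      -- Truncations of `F(x)` and of `(F(x) - F(1)) / (x - 1)`.
      powers quotients : ℕ → Carrier
      powers h = S h (λ t → x ^ deg t)
      quotients h = S h (λ t → geometric x (deg t))

      powers-quotients : ∀ h → x * quotients h + total h ≈ quotients h + powers h
      powers-quotients h = begin
        x * quotients h + total h                  ≈⟨ +-congʳ (S-distribˡ h x _) ⟩
        S h (λ t → x * geometric x (deg t)) + total h ≈⟨ S-+ h _ _ ⟨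
        S h (λ t → x * geometric x (deg t) + 1#)   ≈⟨ S-cong h (λ t → geometric-sum x (deg t)) ⟩
        S h (λ t → geometric x (deg t) + x ^ deg t) ≈⟨ S-+ h _ _ ⟩
        quotients h + powers h                     ∎

      -- `lift` adds one prime and gives `x * powers h`. In a graft the exponent
      -- `suc (toℕ j) + deg q` separates: the sum over `q` gives `powers h`, and the sum over `j`
      -- gives `geometric x (deg p)`.
      powers-suc : ∀ h → powers (suc h) ≈ 1# + τ * (x * (powers h * (1# + quotients h)))
      powers-suc h = trans (S-suc h _) (+-congˡ (*-congˡ (begin
        S h (λ t → x * x ^ deg t) + S h (λ p → Σ (allFin (deg p)) (λ j → S h (λ q → x * x ^ (toℕ j +ℕ deg q))))
          ≈⟨ +-cong (sym (S-distribˡ h x _)) (S-cong h λ p →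
               trans (Σ-cong (allFin (deg p)) (inner p)) (sym (Σ-distribˡ _ (allFin (deg p)) _))) ⟩
        x * powers h + S h (λ p → (x * powers h) * geometric x (deg p))
          ≈⟨ +-congˡ (S-distribˡ h _ _) ⟨
        x * powers h + (x * powers h) * quotients h
          ≈⟨ solve 3 (λ x p q → x :* p :+ (x :* p) :* q := x :* (p :* (con 1 :+ q))) refl x _ _ ⟩
        x * (powers h * (1# + quotients h)) ∎)))
        where
        inner : ∀ p (j : Fin (deg p)) → S h (λ q → x * x ^ (toℕ j +ℕ deg q)) ≈ (x * powers h) * x ^ toℕ j
        inner p j = begin
          S h (λ q → x * x ^ (toℕ j +ℕ deg q))
            ≈⟨ S-cong h (λ q → trans (*-congˡ (^-homo-* x (toℕ j) (deg q))) (sym (*-assoc _ _ _))) ⟩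
          S h (λ q → (x * x ^ toℕ j) * x ^ deg q) ≈⟨ S-distribˡ h _ _ ⟨
          (x * x ^ toℕ j) * powers h
            ≈⟨ solve 3 (λ x y p → (x :* y) :* p := (x :* p) :* y) refl x _ _ ⟩
          (x * powers h) * x ^ toℕ j ∎

  -- The coefficients of 1 and y in the two equations for F(T + y) = F₀ + F₁ y + … and
  -- D(T + y) = D₀ + D₁ y + …, where D(x) = (F(x) - F(1)) / (x - 1) and G = F(1).
  -- The only solution is F₀ = T, D₀ = T - 1; it is reached by improving the precision
  -- one power of τ at a time.
  module CatalyticSystem (R : CommutativeSemiring 0ℓ 0ℓ) where
    open CommutativeSemiring R
    open import Relation.Binary.Reasoning.Setoid setoid
    open import Algebra.Properties.Semiring.Exp semiring using (_^_; ^-homo-*)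
    open import Algebra.Solver.Ring.NaturalCoefficients.Default R

    module _ (+-cancelʳ : ∀ c a b → a + c ≈ b + c → a ≈ b)
      {τ T : Carrier} (T-eq : T ≈ 1# + τ * (T * (T * T)))
      {n : ℕ} (τⁿ≈0 : τ ^ n ≈ 0#)
      {F₀ F₁ D₀ D₁ G : Carrier}
      (F₀-eq : F₀ ≈ 1# + τ * (T * (F₀ * (1# + D₀))))
      (F₁-eq : F₁ ≈ τ * ((F₀ + T * F₁) * (1# + D₀) + T * (F₀ * D₁)))
      (D₀-eq : T * D₀ + G ≈ D₀ + F₀)
      (D₁-eq : D₀ + T * D₁ ≈ D₁ + F₁) where

      -- By `T-eq` this is `T - 1`.
      W : Carrier
      W = τ * (T * (T * T))

      F₀-split : W * D₀ + G ≈ F₀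
      F₀-split = +-cancelʳ D₀ _ _ (begin
        (W * D₀ + G) + D₀   ≈⟨ solve 3 (λ w d g → (w :* d :+ g) :+ d := (con 1 :+ w) :* d :+ g) refl W D₀ G ⟩
        (1# + W) * D₀ + G   ≈⟨ +-congʳ (*-congʳ T-eq) ⟨
        T * D₀ + G          ≈⟨ D₀-eq ⟩
        D₀ + F₀             ≈⟨ +-comm _ _ ⟩
        F₀ + D₀             ∎)

      F₁-split : D₀ + W * D₁ ≈ F₁
      F₁-split = +-cancelʳ D₁ _ _ (begin
        (D₀ + W * D₁) + D₁   ≈⟨ solve 3 (λ w d e → (d :+ w :* e) :+ e := d :+ (con 1 :+ w) :* e) refl W D₀ D₁ ⟩
        D₀ + (1# + W) * D₁   ≈⟨ +-congˡ (*-congʳ T-eq) ⟨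
        D₀ + T * D₁          ≈⟨ D₁-eq ⟩
        D₁ + F₁              ≈⟨ +-comm _ _ ⟩
        F₁ + D₁              ∎)

      vanish : ∀ {m} → n ≤ m → τ ^ m ≈ 0#
      vanish {m} n≤m = begin
        τ ^ m                    ≡⟨ ≡.cong (τ ^_) (ℕ.m+[n∸m]≡n n≤m) ⟨
        τ ^ (n +ℕ (m ∸ n))       ≈⟨ ^-homo-* τ n (m ∸ n) ⟩
        τ ^ n * τ ^ (m ∸ n)      ≈⟨ *-congʳ τⁿ≈0 ⟩
        0# * τ ^ (m ∸ n)         ≈⟨ zeroˡ _ ⟩
        0#                       ∎

      -- Equality after multiplication by `τ ^ i` stands for equality up to precision `n - i`, and
      -- `m` bounds that precision. The recursive call gives up one power, which the factor `τ` in
      -- `F₀-eq` and `F₁-eq` wins back.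
      solution : ∀ m i → n ≤ i +ℕ m → τ ^ i * F₀ ≈ τ ^ i * T × τ ^ i * D₀ ≈ τ ^ i * W
      solution zero i n≤i = both , both
        where
        both : ∀ {a b} → τ ^ i * a ≈ τ ^ i * b
        both = trans (*-congʳ τⁱ≈0) (trans (zeroˡ _) (sym (trans (*-congʳ τⁱ≈0) (zeroˡ _))))
          where τⁱ≈0 = vanish (≡.subst (n ≤_) (ℕ.+-identityʳ i) n≤i)
      solution (suc m) i n≤i+m with solution m (suc i) (≡.subst (n ≤_) (ℕ.+-suc i m) n≤i+m)
      ... | F₀≈T , D₀≈W = F₀-step , D₀-step
        where
        t = τ ^ i
        k = τ * t
        1+D₀-step : k * (1# + D₀) ≈ k * T
        1+D₀-step = begin
          k * (1# + D₀)     ≈⟨ distribˡ _ _ _ ⟩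
          k * 1# + k * D₀   ≈⟨ +-congˡ D₀≈W ⟩
          k * 1# + k * W    ≈⟨ distribˡ _ _ _ ⟨
          k * (1# + W)      ≈⟨ *-congˡ T-eq ⟨
          k * T             ∎
        F₀-step : t * F₀ ≈ t * T
        F₀-step = begin
          t * F₀
            ≈⟨ *-congˡ F₀-eq ⟩
          t * (1# + τ * (T * (F₀ * (1# + D₀))))
            ≈⟨ solve 5 (λ t u T F D → t :* (con 1 :+ u :* (T :* (F :* D)))
                   := t :+ T :* (u :* t :* F) :* D) refl t τ T F₀ (1# + D₀) ⟩
          t + T * (k * F₀) * (1# + D₀)
            ≈⟨ +-congˡ (*-congʳ (*-congˡ F₀≈T)) ⟩
          t + T * (k * T) * (1# + D₀)
            ≈⟨ solve 4 (λ t k T D → t :+ T :* (k :* T) :* D := t :+ T :* T :* (k :* D)) refl t k T (1# + D₀) ⟩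
          t + T * T * (k * (1# + D₀))
            ≈⟨ +-congˡ (*-congˡ 1+D₀-step) ⟩
          t + T * T * (k * T)
            ≈⟨ solve 3 (λ t u T → t :+ T :* T :* (u :* t :* T)
                   := t :* (con 1 :+ u :* (T :* (T :* T)))) refl t τ T ⟩
          t * (1# + W)
            ≈⟨ *-congˡ T-eq ⟨
          t * T ∎
        F₁-step : k * F₁ ≈ k * (W + W * D₁)
        F₁-step = begin
          k * F₁                    ≈⟨ *-congˡ F₁-split ⟨
          k * (D₀ + W * D₁)         ≈⟨ distribˡ _ _ _ ⟩
          k * D₀ + k * (W * D₁)     ≈⟨ +-congʳ D₀≈W ⟩
          k * W + k * (W * D₁)      ≈⟨ distribˡ _ _ _ ⟨
          k * (W + W * D₁)          ∎
        D₀-step : t * D₀ ≈ t * W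
        -- The unknown `D₁` enters both sides with the same coefficient `t * W` and is cancelled:
        -- this is what singles out the point `T`.
        D₀-step = +-cancelʳ (t * (W * D₁)) _ _ (begin
          t * D₀ + t * (W * D₁)
            ≈⟨ distribˡ _ _ _ ⟨
          t * (D₀ + W * D₁)
            ≈⟨ *-congˡ (trans F₁-split F₁-eq) ⟩
          t * (τ * ((F₀ + T * F₁) * (1# + D₀) + T * (F₀ * D₁)))
            ≈⟨ solve 7 (λ t u F T f D d → t :* (u :* ((F :+ T :* f) :* D :+ T :* (F :* d)))
                   := (u :* t :* F :+ T :* (u :* t :* f)) :* D :+ T :* (u :* t :* F :* d)) refl t τ F₀ T F₁ (1# + D₀) D₁ ⟩
          (k * F₀ + T * (k * F₁)) * (1# + D₀) + T * (k * F₀ * D₁)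
            ≈⟨ +-cong (*-congʳ (+-cong F₀≈T (*-congˡ F₁-step))) (*-congˡ (*-congʳ F₀≈T)) ⟩
          (k * T + T * (k * (W + W * D₁))) * (1# + D₀) + T * (k * T * D₁)
            ≈⟨ solve 5 (λ k T W d D → (k :* T :+ T :* (k :* (W :+ W :* d))) :* D :+ T :* (k :* T :* d)
                   := T :* (con 1 :+ W :+ W :* d) :* (k :* D) :+ T :* T :* (k :* d)) refl k T W D₁ (1# + D₀) ⟩
          T * (1# + W + W * D₁) * (k * (1# + D₀)) + T * T * (k * D₁)
            ≈⟨ +-congʳ (*-congˡ 1+D₀-step) ⟩
          T * (1# + W + W * D₁) * (k * T) + T * T * (k * D₁)
            ≈⟨ solve 4 (λ k T W d → T :* (con 1 :+ W :+ W :* d) :* (k :* T) :+ T :* T :* (k :* d)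
                   := T :* T :* k :* (con 1 :+ W) :* (con 1 :+ d)) refl k T W D₁ ⟩
          T * T * k * (1# + W) * (1# + D₁)
            ≈⟨ *-congʳ (*-congˡ T-eq) ⟨
          T * T * k * T * (1# + D₁)
            ≈⟨ solve 4 (λ t u T d → T :* T :* (u :* t) :* T :* (con 1 :+ d)
                   := t :* (u :* (T :* (T :* T))) :+ t :* (u :* (T :* (T :* T)) :* d)) refl t τ T D₁ ⟩
          t * W + t * (W * D₁) ∎)

      -- At the solution `F₀-split` reads `W * W + G ≈ T`; adding `T + T` completes `W * W` to
      -- `T * T + 1#`.
      total-eq : G + (T * T + 1#) ≈ T + (T + T)
      total-eq = begin
        G + (T * T + 1#)                ≈⟨ +-congˡ (+-congʳ (*-cong T-eq T-eq)) ⟩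
        G + ((1# + W) * (1# + W) + 1#)
          ≈⟨ solve 2 (λ g w → g :+ ((con 1 :+ w) :* (con 1 :+ w) :+ con 1)
                   := (w :* w :+ g) :+ ((con 1 :+ w) :+ (con 1 :+ w))) refl G W ⟩
        (W * W + G) + ((1# + W) + (1# + W)) ≈⟨ +-cong (+-congʳ (*-congˡ D₀≈W)) (+-cong T-eq T-eq) ⟨
        (W * D₀ + G) + (T + T)          ≈⟨ +-congʳ (trans F₀-split F₀≈T) ⟩
        T + (T + T)                     ∎
        where
        strip : ∀ {a b} → τ ^ 0 * a ≈ τ ^ 0 * b → a ≈ b
        strip eq = trans (sym (*-identityˡ _)) (trans eq (*-identityˡ _))
        F₀≈T = strip (proj₁ (solution n 0 ℕ.≤-refl))
        D₀≈W = strip (proj₂ (solution n 0 ℕ.≤-refl))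

  -- Formal power series and their truncation

  module PowerSeries (R : CommutativeSemiring 0ℓ 0ℓ) where
    open CommutativeSemiring R
    open import Relation.Binary.Reasoning.Setoid setoid
    open import Algebra.Solver.Ring.NaturalCoefficients.Default R

    Series : Set
    Series = ℕ → Carrier

    const : Carrier → Series
    const a zero    = a
    const a (suc _) = 0#

    infixl 7 _⊛_
    _⊛_ : Series → Series → Series
    (f ⊛ g) zero    = f 0 * g 0
    (f ⊛ g) (suc n) = f 0 * g (suc n) + ((f ∘ suc) ⊛ g) n

    -- The bounds `i ≤ n` are what makes truncated equality compatible with the product.
    ⊛-cong : ∀ {f f′ g g′} n → (∀ i → i ≤ n → f i ≈ f′ i) → (∀ i → i ≤ n → g i ≈ g′ i) →
      (f ⊛ g) n ≈ (f′ ⊛ g′) n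
    ⊛-cong zero p q = *-cong (p 0 z≤n) (q 0 z≤n)
    ⊛-cong (suc n) p q = +-cong (*-cong (p 0 z≤n) (q (suc n) ℕ.≤-refl))
      (⊛-cong n (λ i i≤n → p (suc i) (s≤s i≤n)) (λ i i≤n → q i (ℕ.m≤n⇒m≤1+n i≤n)))

    ⊛-zeroˡ : ∀ {f} g n → (∀ i → f i ≈ 0#) → (f ⊛ g) n ≈ 0#
    ⊛-zeroˡ g zero z = trans (*-congʳ (z 0)) (zeroˡ _)
    ⊛-zeroˡ g (suc n) z = trans (+-cong (trans (*-congʳ (z 0)) (zeroˡ _)) (⊛-zeroˡ g n (z ∘ suc))) (+-identityˡ 0#)

    const-⊛ : ∀ a g n → (const a ⊛ g) n ≈ a * g n
    const-⊛ a g zero = refl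
    const-⊛ a g (suc n) = trans (+-congˡ (⊛-zeroˡ g n λ _ → refl)) (+-identityʳ _)

    ⊛-distribʳ : ∀ h f g n → ((λ i → f i + g i) ⊛ h) n ≈ (f ⊛ h) n + (g ⊛ h) n
    ⊛-distribʳ h f g zero = distribʳ _ _ _
    ⊛-distribʳ h f g (suc n) = trans (+-cong (distribʳ _ _ _) (⊛-distribʳ h (f ∘ suc) (g ∘ suc) n))
      (solve 4 (λ a b c d → (a :+ b) :+ (c :+ d) := (a :+ c) :+ (b :+ d)) refl _ _ _ _)

    ⊛-sucʳ : ∀ f g n → (f ⊛ g) (suc n) ≈ f (suc n) * g 0 + (f ⊛ (g ∘ suc)) n
    ⊛-sucʳ f g zero = +-comm _ _
    ⊛-sucʳ f g (suc n) = trans (+-congˡ (⊛-sucʳ (f ∘ suc) g n))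
      (solve 3 (λ a b c → a :+ (b :+ c) := b :+ (a :+ c)) refl _ _ _)

    ⊛-comm : ∀ f g n → (f ⊛ g) n ≈ (g ⊛ f) n
    ⊛-comm f g zero = *-comm _ _
    ⊛-comm f g (suc n) = trans (+-cong (*-comm _ _) (⊛-comm (f ∘ suc) g n)) (sym (⊛-sucʳ g f n))

    ⊛-scale : ∀ a f g n → ((λ i → a * f i) ⊛ g) n ≈ a * (f ⊛ g) n
    ⊛-scale a f g zero = *-assoc _ _ _
    ⊛-scale a f g (suc n) = trans (+-cong (*-assoc _ _ _) (⊛-scale a (f ∘ suc) g n)) (sym (distribˡ _ _ _))

    ⊛-assoc : ∀ f g h n → ((f ⊛ g) ⊛ h) n ≈ (f ⊛ (g ⊛ h)) n
    ⊛-assoc f g h zero = *-assoc _ _ _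
    ⊛-assoc f g h (suc n) = begin
      f 0 * g 0 * h (suc n) + ((λ i → f 0 * g (suc i) + ((f ∘ suc) ⊛ g) i) ⊛ h) n
        ≈⟨ +-congˡ (trans (⊛-distribʳ h _ _ n) (+-cong (⊛-scale (f 0) (g ∘ suc) h n) (⊛-assoc (f ∘ suc) g h n))) ⟩
      f 0 * g 0 * h (suc n) + (f 0 * ((g ∘ suc) ⊛ h) n + ((f ∘ suc) ⊛ (g ⊛ h)) n)
        ≈⟨ solve 5 (λ a b c d e → a :* b :* c :+ (a :* d :+ e) := a :* (b :* c :+ d) :+ e) refl _ _ _ _ _ ⟩
      f 0 * (g ⊛ h) (suc n) + ((f ∘ suc) ⊛ (g ⊛ h)) n ∎

    -- Power series modulo the N-th power of the variable, as a coarser equality on all series.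
    truncated : ℕ → CommutativeSemiring 0ℓ 0ℓ
    truncated N = record
      { Carrier = Series
      ; _≈_ = λ f g → ∀ n → n < N → f n ≈ g n
      ; _+_ = λ f g n → f n + g n
      ; _*_ = _⊛_
      ; 0# = λ _ → 0#
      ; 1# = const 1#
      ; isCommutativeSemiring = isCommutativeSemiringˡ record
        { +-isCommutativeMonoid = record
          { isMonoid = record
            { isSemigroup = record
              { isMagma = record { isEquivalence = equiv ; ∙-cong = λ p q n n<N → +-cong (p n n<N) (q n n<N) }
              ; assoc = λ _ _ _ _ _ → +-assoc _ _ _ }
            ; identity = (λ _ _ _ → +-identityˡ _) , (λ _ _ _ → +-identityʳ _) }
          ; comm = λ _ _ _ _ → +-comm _ _ }
        ; *-isCommutativeMonoid = record
          { isMonoid = record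
            { isSemigroup = record
              { isMagma = record
                { isEquivalence = equiv
                ; ∙-cong = λ p q n n<N → ⊛-cong n
                    (λ i i≤n → p i (ℕ.≤-<-trans i≤n n<N)) (λ i i≤n → q i (ℕ.≤-<-trans i≤n n<N)) }
              ; assoc = λ f g h n _ → ⊛-assoc f g h n }
            ; identity = (λ f n _ → one f n) , (λ f n _ → trans (⊛-comm f _ n) (one f n)) }
          ; comm = λ f g n _ → ⊛-comm f g n }
        ; distribʳ = λ h f g n _ → ⊛-distribʳ h f g n
        ; zeroˡ = λ g n _ → ⊛-zeroˡ g n λ _ → refl
        }
      }
      where
      one : ∀ f n → (const 1# ⊛ f) n ≈ f n
      one f n = trans (const-⊛ 1# f n) (*-identityˡ _)
      equiv : IsEquivalence (λ f g → ∀ n → n < N → f n ≈ g n)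
      equiv = record
        { refl = λ _ _ → refl
        ; sym = λ p n n<N → sym (p n n<N)
        ; trans = λ p q n n<N → trans (p n n<N) (q n n<N) }

-- Powers of `T`, and tree sums evaluated at `T`

module Coefficients where
  open GeneratingFunctions
  open import Algebra.Bundles using (CommutativeSemiring)
  open import Data.Nat using (ℕ; zero; suc; _+_; _*_; _<_; z≤n; s≤s; _!)
  open import Data.Nat.Properties
  open import Data.Nat.Tactic.RingSolver using (solve-∀)
  open import Data.List using ([]; _∷_)
  open import Function using (_∘_)
  open import Relation.Binary.PropositionalEquality

  -- ternary r is the r-th power of the series T = 1 + τ T³, by T^(r+1) = T^r + τ T^(r+3).
  ternary : ℕ → ℕ → ℕ
  ternary _       zero    = 1
  ternary zero    (suc n) = 0
  ternary (suc r) (suc n) = ternary r (suc n) + ternary (3 + r) n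

  -- Over a common denominator the recurrence reduces to `(2n+r+3) r + (n+1) (r+3) = (r+1)
  -- (3n+r+3)`.
  ternary-!-step : ∀ n r →
    ternary r (suc n) * ((suc n) ! * (2 + (2 * n + r)) !) ≡ r * (2 + (3 * n + r)) ! →
    ternary (3 + r) n * (n ! * (2 * n + (3 + r)) !) ≡ (3 + r) * (3 * n + (2 + r)) ! →
    ternary (suc r) (suc n) * ((suc n) ! * (2 * suc n + suc r) !) ≡ suc r * (3 * suc n + r) !
  ternary-!-step n r eq₁ eq₂ = begin
    (a + b) * ((suc n) ! * (2 * suc n + suc r) !)
      ≡⟨ cong (λ m → (a + b) * ((suc n) ! * m !)) (index₁ n r) ⟩
    (a + b) * ((suc n * n !) * ((3 + (2 * n + r)) * f))
      ≡⟨ expand a b (suc n) (n !) (3 + (2 * n + r)) f ⟩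
    (3 + (2 * n + r)) * (a * ((suc n) ! * f)) + suc n * (b * (n ! * (3 + (2 * n + r)) !))
      ≡⟨ cong₂ (λ p m → (3 + (2 * n + r)) * p + suc n * (b * (n ! * m !))) eq₁ (sym (index₂ n r)) ⟩
    (3 + (2 * n + r)) * (r * g) + suc n * (b * (n ! * (2 * n + (3 + r)) !))
      ≡⟨ cong (λ p → (3 + (2 * n + r)) * (r * g) + suc n * p) eq₂ ⟩
    (3 + (2 * n + r)) * (r * g) + suc n * ((3 + r) * (3 * n + (2 + r)) !)
      ≡⟨ cong (λ m → (3 + (2 * n + r)) * (r * g) + suc n * ((3 + r) * m !)) (index₃ n r) ⟩
    (3 + (2 * n + r)) * (r * g) + suc n * ((3 + r) * g)
      ≡⟨ combine n r g ⟩
    suc r * (3 + (3 * n + r)) !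
      ≡⟨ cong (λ m → suc r * m !) (index₄ n r) ⟨
    suc r * (3 * suc n + r) ! ∎
    where
    open ≡-Reasoning
    a = ternary r (suc n)
    b = ternary (3 + r) n
    f = (2 + (2 * n + r)) !
    g = (2 + (3 * n + r)) !
    expand : ∀ a b m p k f → (a + b) * ((m * p) * (k * f)) ≡ k * (a * (m * p * f)) + m * (b * (p * (k * f)))
    expand = solve-∀
    combine : ∀ n r g → (3 + (2 * n + r)) * (r * g) + suc n * ((3 + r) * g) ≡ suc r * ((3 + (3 * n + r)) * g)
    combine = solve-∀
    index₁ : ∀ n r → 2 * suc n + suc r ≡ 3 + (2 * n + r)
    index₁ = solve-∀
    index₂ : ∀ n r → 2 * n + (3 + r) ≡ 3 + (2 * n + r)
    index₂ = solve-∀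
    index₃ : ∀ n r → 3 * n + (2 + r) ≡ 2 + (3 * n + r)
    index₃ = solve-∀
    index₄ : ∀ n r → 3 * suc n + r ≡ 3 + (3 * n + r)
    index₄ = solve-∀

  -- Raney's formula without division: the coefficient of `τⁿ` in `Tʳ` is `r / (3n+r)` times the
  -- binomial coefficient of `3n+r` over `n`, here with `suc r` for `r`.
  ternary-! : ∀ n r → ternary (suc r) n * (n ! * (2 * n + suc r) !) ≡ suc r * (3 * n + r) !
  ternary-! zero r = trans (*-identityˡ _) (*-identityˡ _)
  -- At exponent 0 both sides of the first premise are 0.
  ternary-! (suc n) zero = ternary-!-step n 0 refl (ternary-! n 2)
  ternary-! (suc n) (suc r) = ternary-!-step n (suc r)
    (subst₂ (λ p q → ternary (suc r) (suc n) * ((suc n) ! * p !) ≡ suc r * q !)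
      (index₁ n r) (index₂ n r) (ternary-! (suc n) r))
    (ternary-! n (3 + r))
    where
    index₁ : ∀ n r → 2 * suc n + suc r ≡ 2 + (2 * n + suc r)
    index₁ = solve-∀
    index₂ : ∀ n r → 3 * suc n + r ≡ 2 + (3 * n + suc r)
    index₂ = solve-∀

  -- Over the denominator `(n+2)! (2n+3)!`, the terms `3 T` and `T²` contribute `3 (n+2)` and `3n+4`
  -- times `(3n+3)!`; their difference is the constant 2 of the formula.
  total-! : ∀ n c → c + ternary 2 (suc n) ≡ ternary 1 (suc n) + (ternary 1 (suc n) + ternary 1 (suc n)) →
    c * (n + 2) ! * (2 * n + 3) ! ≡ 2 * (3 * n + 3) !
  total-! n c eq = +-cancelʳ-≡ (t₂ * (n + 2) ! * (2 * n + 3) !) _ _ (begin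
    c * (n + 2) ! * (2 * n + 3) ! + t₂ * (n + 2) ! * (2 * n + 3) !
      ≡⟨ factor c t₂ ((n + 2) !) ((2 * n + 3) !) ⟩
    (c + t₂) * ((n + 2) ! * (2 * n + 3) !)
      ≡⟨ cong (_* ((n + 2) ! * (2 * n + 3) !)) eq ⟩
    (t₁ + (t₁ + t₁)) * ((n + 2) ! * (2 * n + 3) !)
      ≡⟨ cong (λ m → (t₁ + (t₁ + t₁)) * (m * (2 * n + 3) !)) fact ⟩
    (t₁ + (t₁ + t₁)) * ((2 + n) * (suc n) ! * (2 * n + 3) !)
      ≡⟨ triple t₁ n ((suc n) !) ((2 * n + 3) !) ⟩
    3 * (2 + n) * (t₁ * ((suc n) ! * (2 * n + 3) !))
      ≡⟨ cong (3 * (2 + n) *_) one ⟩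
    3 * (2 + n) * (3 * n + 3) !
      ≡⟨ split n ((3 * n + 3) !) ⟩
    2 * (3 * n + 3) ! + (4 + 3 * n) * (3 * n + 3) !
      ≡⟨ cong (2 * (3 * n + 3) ! +_) two ⟨
    2 * (3 * n + 3) ! + t₂ * (n + 2) ! * (2 * n + 3) ! ∎)
    where
    open ≡-Reasoning
    t₁ = ternary 1 (suc n)
    t₂ = ternary 2 (suc n)
    fact : (n + 2) ! ≡ (2 + n) * (suc n) !
    fact = cong _! (+-comm n 2)
    factor : ∀ c t a b → c * a * b + t * a * b ≡ (c + t) * (a * b)
    factor = solve-∀
    triple : ∀ t n a b → (t + (t + t)) * ((2 + n) * a * b) ≡ 3 * (2 + n) * (t * (a * b))
    triple = solve-∀
    split : ∀ n f → 3 * (2 + n) * f ≡ 2 * f + (4 + 3 * n) * f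
    split = solve-∀
    index₁ : ∀ n → 2 * suc n + 1 ≡ 2 * n + 3
    index₁ = solve-∀
    index₂ : ∀ n → 3 * suc n + 0 ≡ 3 * n + 3
    index₂ = solve-∀
    index₃ : ∀ n → 2 * suc n + 2 ≡ suc (2 * n + 3)
    index₃ = solve-∀
    index₄ : ∀ n → 3 * suc n + 1 ≡ suc (3 * n + 3)
    index₄ = solve-∀
    one : t₁ * ((suc n) ! * (2 * n + 3) !) ≡ (3 * n + 3) !
    one = begin
      t₁ * ((suc n) ! * (2 * n + 3) !)      ≡⟨ cong (λ m → t₁ * ((suc n) ! * m !)) (index₁ n) ⟨
      t₁ * ((suc n) ! * (2 * suc n + 1) !)  ≡⟨ ternary-! (suc n) 0 ⟩
      1 * (3 * suc n + 0) !                 ≡⟨ *-identityˡ _ ⟩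
      (3 * suc n + 0) !                     ≡⟨ cong _! (index₂ n) ⟩
      (3 * n + 3) !                         ∎
    double : ∀ t n a b → 2 * (t * ((2 + n) * a) * b) ≡ t * (a * (suc (2 * n + 3) * b))
    double = solve-∀
    index₅ : ∀ n → suc (3 * n + 3) ≡ 4 + 3 * n
    index₅ = solve-∀
    two : t₂ * (n + 2) ! * (2 * n + 3) ! ≡ (4 + 3 * n) * (3 * n + 3) !
    -- The factor 2 turns `(n+2) (2n+3)!` into `(2n+4)!`, the factorial that `ternary-!` has for the
    -- square of `T`.
    two = *-cancelˡ-≡ _ _ 2 (begin
      2 * (t₂ * (n + 2) ! * (2 * n + 3) !)              ≡⟨ cong (λ m → 2 * (t₂ * m * (2 * n + 3) !)) fact ⟩
      2 * (t₂ * ((2 + n) * (suc n) !) * (2 * n + 3) !)  ≡⟨ double t₂ n ((suc n) !) ((2 * n + 3) !) ⟩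
      t₂ * ((suc n) ! * (suc (2 * n + 3)) !)            ≡⟨ cong (λ m → t₂ * ((suc n) ! * m !)) (index₃ n) ⟨
      t₂ * ((suc n) ! * (2 * suc n + 2) !)              ≡⟨ ternary-! (suc n) 1 ⟩
      2 * (3 * suc n + 1) !                             ≡⟨ cong (λ m → 2 * m !) (index₄ n) ⟩
      2 * (suc (3 * n + 3) * (3 * n + 3) !)             ≡⟨ cong (λ m → 2 * (m * (3 * n + 3) !)) (index₅ n) ⟩
      2 * ((4 + 3 * n) * (3 * n + 3) !)                 ∎)

  module P = PowerSeries +-*-commutativeSemiring
  open P using (_⊛_; const)

  -- Both sides obey the recurrence of `ternary` in `r`; the induction is lexicographic in degree
  -- and exponent.
  ternary-⊛ : ∀ n r s → (ternary r ⊛ ternary s) n ≡ ternary (r + s) n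
  ternary-⊛ zero r s = refl
  ternary-⊛ (suc n) zero s = trans (cong₂ _+_ (*-identityˡ _) (P.⊛-zeroˡ (ternary s) n λ _ → refl)) (+-identityʳ _)
  ternary-⊛ (suc n) (suc r) s = begin
    1 * ternary s (suc n) + ((λ i → ternary r (suc i) + ternary (3 + r) i) ⊛ ternary s) n
      ≡⟨ cong (1 * ternary s (suc n) +_) (P.⊛-distribʳ (ternary s) (ternary r ∘ suc) (ternary (3 + r)) n) ⟩
    1 * ternary s (suc n) + (((ternary r ∘ suc) ⊛ ternary s) n + (ternary (3 + r) ⊛ ternary s) n)
      ≡⟨ +-assoc (1 * ternary s (suc n)) _ _ ⟨
    (ternary r ⊛ ternary s) (suc n) + (ternary (3 + r) ⊛ ternary s) n
      ≡⟨ cong₂ _+_ (ternary-⊛ (suc n) r s) (ternary-⊛ n (3 + r) s) ⟩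
    ternary (r + s) (suc n) + ternary (3 + r + s) n ∎
    where open ≡-Reasoning

  τ : P.Series
  τ zero    = 0
  τ (suc n) = const 1 n

  τ-⊛ : ∀ f n → (τ ⊛ f) (suc n) ≡ f n
  τ-⊛ f n = trans (P.const-⊛ 1 f n) (*-identityˡ (f n))

  δ : ℕ → ℕ → ℕ
  δ zero    zero    = 1
  δ zero    (suc n) = 0
  δ (suc m) zero    = 0
  δ (suc m) (suc n) = δ m n

  δ-< : ∀ {m n} → n < m → δ m n ≡ 0
  δ-< {suc m} {zero} _ = refl
  δ-< {suc m} {suc n} (s≤s lt) = δ-< lt

  module Truncation (N : ℕ) where
    R : CommutativeSemiring _ _
    R = P.truncated N
    module R = CommutativeSemiring R
    open import Algebra.Properties.Semiring.Exp R.semiring using (_^_)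
    open import Algebra.Solver.Ring.NaturalCoefficients.Default R
    module Q = PowerSeries R
    R₂ : CommutativeSemiring _ _
    R₂ = Q.truncated 2
    module R₂ = CommutativeSemiring R₂
    open import Algebra.Properties.Semiring.Exp R₂.semiring using () renaming (_^_ to _^₂_)

    T : R.Carrier
    T = ternary 1

    T-eq : T R.≈ R.1# R.+ τ R.* (T R.* (T R.* T))
    T-eq zero _ = refl
    T-eq (suc n) _ = sym (trans (τ-⊛ (T ⊛ (T ⊛ T)) n)
      (trans (P.⊛-cong n (λ _ _ → refl) (λ i _ → ternary-⊛ i 1 1)) (ternary-⊛ n 1 2)))

    τ^ : ∀ m n → (τ ^ m) n ≡ δ m n
    τ^ zero zero = refl
    τ^ zero (suc n) = refl
    τ^ (suc m) zero = refl
    τ^ (suc m) (suc n) = trans (τ-⊛ (τ ^ m) n) (τ^ m n)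

    τ₂ : R₂.Carrier
    τ₂ = Q.const τ

    τ₂^ : ∀ m i → (τ₂ ^₂ m) i R.≈ Q.const (τ ^ m) i
    τ₂^ zero i = R.refl
    τ₂^ (suc m) zero = R.*-congˡ {τ} (τ₂^ m 0)
    τ₂^ (suc m) (suc i) = R.trans (Q.const-⊛ τ (τ₂ ^₂ m) (suc i))
      (R.trans (R.*-congˡ {τ} (τ₂^ m (suc i))) (R.zeroʳ τ))

    -- The point T + y of R[y]/(y²).
    x : R₂.Carrier
    x 0 = T
    x 1 = R.1#
    x (suc (suc _)) = R.0#

    τᴺ≈0 : τ ^ N R.≈ R.0#
    τᴺ≈0 n n<N = trans (τ^ N n) (δ-< n<N)

    module S₁ = TreeSum R τ
    module S₂ = TreeSum R₂ τ₂
    module L₁ = ListSum R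
    module L₂ = ListSum R₂

    -- The weights do not contain `y`, so `F(1)` has no part of order 1; accordingly `G` is absent
    -- from `D₁-eq`.
    total₂ : ∀ ts i → L₂.Σ ts (S₂.weigh (λ _ → R₂.1#)) i R.≈ Q.const (L₁.Σ ts (S₁.weigh (λ _ → R.1#))) i
    total₂ [] zero = R.refl
    total₂ [] (suc i) = R.refl
    total₂ (t ∷ ts) zero = R.+-cong (R.*-congʳ (τ₂^ (size t) 0)) (total₂ ts 0)
    total₂ (t ∷ ts) (suc i) = R.trans (R.+-cong
      (R.trans (Q.⊛-comm (τ₂ ^₂ size t) R₂.1# (suc i))
        (R.trans (Q.const-⊛ R.1# (τ₂ ^₂ size t) (suc i)) (R.trans (R.*-identityˡ _) (τ₂^ (size t) (suc i)))))
      (total₂ ts (suc i))) (R.+-identityˡ R.0#)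

    F D : R₂.Carrier
    F = S₂.powers x N
    D = S₂.quotients x N

    -- `powers-suc` relates the heights `suc N` and `N`; since `τ₂ ^₂ N` vanishes, `S-stable` with
    -- prefactor 1 identifies them.
    F-eq : F R₂.≈ R₂.1# R₂.+ τ₂ R₂.* (x R₂.* (F R₂.* (R₂.1# R₂.+ D)))
    F-eq = R₂.trans (R₂.sym (R₂.trans (R₂.sym (R₂.*-identityˡ _))
        (R₂.trans (S₂.S-stable N 0 _ τ₂ᴺ≈0) (R₂.*-identityˡ _))))
      (S₂.powers-suc x N)
      where
      τ₂ᴺ≈0 : τ₂ ^₂ N R₂.≈ R₂.0#
      τ₂ᴺ≈0 zero _ = R.trans (τ₂^ N 0) τᴺ≈0
      τ₂ᴺ≈0 (suc i) _ = τ₂^ N (suc i)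

    total-eq : S₁.total N R.+ (T R.* T R.+ R.1#) R.≈ T R.+ (T R.+ T)
    total-eq = CatalyticSystem.total-eq R (λ c a b eq n lt → +-cancelʳ-≡ (c n) (a n) (b n) (eq n lt))
      T-eq {N} τᴺ≈0
      {F 0} {F 1} {D 0} {D 1}
      (F-eq 0 (s≤s z≤n))
      (R.trans (F-eq 1 (s≤s (s≤s z≤n)))
        -- The left side is the coefficient of `y` as the product unfolds; the zeros come from
        -- `R₂.1#` and `τ₂`, which are constant in `y`.
        (solve 6 (λ τ T F f D d →
          con 0 :+ (τ :* (T :* (F :* (con 0 :+ d) :+ f :* (con 1 :+ D)) :+ con 1 :* (F :* (con 1 :+ D)))
                    :+ con 0 :* (T :* (F :* (con 1 :+ D))))
          := τ :* ((F :+ T :* f) :* (con 1 :+ D) :+ T :* (F :* d))) R.refl τ T (F 0) (F 1) (D 0) (D 1)))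
      (R.trans (R.+-congˡ (R.sym (total₂ (gen N) 0))) (S₂.powers-quotients x N 0 (s≤s z≤n)))
      (R.trans (solve 3 (λ T D d → D :+ T :* d := (T :* d :+ con 1 :* D) :+ con 0) R.refl T (D 0) (D 1))
        (R.trans (R.+-congˡ (R.sym (total₂ (gen N) 1))) (S₂.powers-quotients x N 1 (s≤s (s≤s z≤n)))))

-- Listing the intervals of each `v`, and the final count

open import Defs
open import Data.Nat using (ℕ; _+_; _*_)
open import Data.Nat using (_!)
open import Data.Product using (_×_; ∃-syntax)
open import Data.List using (map)
open import Data.Nat.ListAction using (sum)
open import Relation.Binary.PropositionalEquality using (_≡_)

open Words hiding (here; there)
open Paths
open GeneratingFunctions
open Coefficients
open import Data.Nat using (zero; suc; _<_; s≤s)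
open import Data.Nat.Properties
open import Data.Nat.ListAction.Properties using (sum-++)
open import Data.Bool using (if_then_else_)
open import Data.Product using (_,_; proj₁; proj₂)
open import Data.Sum using (inj₁; inj₂)
open import Data.List using (List; []; _∷_; _++_; concatMap; allFin; filter; length; drop)
open import Data.List.Properties using (≡-dec; map-++; map-∘; length-map; length-++; ∷-injectiveʳ)
open import Data.List.Membership.Propositional using (_∈_)
open import Data.List.Membership.Propositional.Properties using (∈-map⁺; ∈-map⁻; ∈-++⁺ˡ; ∈-++⁺ʳ; ∈-++⁻)
open import Data.List.Membership.Propositional.Properties using (∈-concatMap⁺; ∈-concatMap⁻; ∈-allFin)
open import Data.List.Membership.Propositional.Properties using (∈-filter⁺; ∈-filter⁻)
open import Data.List.Relation.Unary.Any as Any using (here; there)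
open import Data.List.Relation.Unary.All as All using (_∷_)
open import Data.List.Relation.Unary.AllPairs using ([]; _∷_)
open import Data.List.Relation.Unary.Unique.Propositional using (Unique)
import Data.List.Relation.Unary.Unique.Propositional.Properties as Unique
open import Function using (_∘_)
open import Function.Bundles using (_⇔_; mk⇔)
open import Relation.Nullary using (¬_; Dec; yes; no; does; contradiction)
open import Relation.Binary.Definitions using (DecidableEquality)
open import Relation.Binary.PropositionalEquality using (_≢_; refl; sym; trans; cong; cong₂; subst; module ≡-Reasoning)

unique-concatMap : ∀ {A B : Set} (f : A → List B) → (∀ a → Unique (f a)) →
  (∀ {a b x} → x ∈ f a → x ∈ f b → a ≡ b) → ∀ {as} → Unique as → Unique (concatMap f as)
unique-concatMap f u disjoint [] = []
unique-concatMap f u disjoint {a ∷ as} (a∉as ∷ us) = Unique.++⁺ (u a) (unique-concatMap f u disjoint us)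
  λ { (x∈fa , x∈rest) → separate a∉as (∈-concatMap⁻ f {xs = as} x∈rest) x∈fa }
  where
  separate : ∀ {bs x} → All.All (a ≢_) bs → Any.Any ((x ∈_) ∘ f) bs → ¬ x ∈ f a
  separate (a≢b ∷ _) (here x∈fb) x∈fa = a≢b (disjoint x∈fa x∈fb)
  separate (_ ∷ p) (there q) = separate p q

unique-map : ∀ {A B : Set} (f : A → B) {as} → (∀ {a b} → a ∈ as → b ∈ as → f a ≡ f b → a ≡ b) →
  Unique as → Unique (map f as)
unique-map f inj [] = []
unique-map f {a ∷ as} inj (a∉as ∷ us) =
  All.tabulate (λ fb∈ fa≡ → let b , b∈ , eq = ∈-map⁻ f fb∈ in
    All.lookup a∉as b∈ (inj (here refl) (there b∈) (trans fa≡ eq)))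
  ∷ unique-map f (λ p q → inj (there p) (there q)) us

graft-injective₁ : ∀ {p p′ j j′ q q′} → graft p j q ≡ graft p′ j′ q′ → p ≡ p′
graft-injective₁ refl = refl

graft-injective₂ : ∀ {p j j′ q q′} → graft p j q ≡ graft p j′ q′ → j ≡ j′
graft-injective₂ refl = refl

graft-injective₃ : ∀ {p j q q′} → graft p j q ≡ graft p j q′ → q ≡ q′
graft-injective₃ refl = refl

graftsAt : List Tree → Tree → List Tree
graftsAt qs p = concatMap (λ j → map (graft p j) qs) (allFin (deg p))

∈-graftsAt⁻ : ∀ {t} p qs → t ∈ graftsAt qs p → ∃[ j ] ∃[ q ] t ≡ graft p j q
∈-graftsAt⁻ p qs t∈ with Any.satisfied (∈-concatMap⁻ _ {xs = allFin (deg p)} t∈)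
... | j , t∈j with ∈-map⁻ (graft p j) t∈j
... | q , _ , eq = j , q , eq

∈-grafts⁻ : ∀ {t} ps qs → t ∈ grafts ps qs → ∃[ p ] ∃[ j ] ∃[ q ] t ≡ graft p j q
∈-grafts⁻ ps qs t∈ with Any.satisfied (∈-concatMap⁻ (graftsAt qs) {xs = ps} t∈)
... | p , t∈p = p , ∈-graftsAt⁻ p qs t∈p

unique-grafts : ∀ {ps qs} → Unique ps → Unique qs → Unique (grafts ps qs)
unique-grafts {ps} {qs} ups uqs = unique-concatMap _
  (λ p → unique-concatMap _ (λ j → Unique.map⁺ graft-injective₃ uqs) same-j (Unique.allFin⁺ (deg p)))
  same-p ups
  where
  same-j : ∀ {p j j′ t} → t ∈ map (graft p j) qs → t ∈ map (graft p j′) qs → j ≡ j′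
  same-j {p} {j} {j′} t∈ t∈′ with ∈-map⁻ (graft p j) t∈ | ∈-map⁻ (graft p j′) t∈′
  ... | _ , _ , refl | _ , _ , eq = graft-injective₂ eq
  same-p : ∀ {p p′ t} → t ∈ graftsAt qs p → t ∈ graftsAt qs p′ → p ≡ p′
  same-p {p} {p′} t∈ t∈′ with ∈-graftsAt⁻ p qs t∈ | ∈-graftsAt⁻ p′ qs t∈′
  ... | _ , _ , refl | _ , _ , eq = graft-injective₁ eq

unique-gen : ∀ h → Unique (gen h)
unique-gen zero = []
unique-gen (suc h) =
  All.tabulate leaf∉ ∷
  Unique.++⁺ (Unique.map⁺ (λ { refl → refl }) (unique-gen h)) (unique-grafts (unique-gen h) (unique-gen h))
    λ { (t∈ , t∈′) → lift≢graft t∈ t∈′ }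
  where
  lift≢graft : ∀ {t} → t ∈ map lift (gen h) → ¬ t ∈ grafts (gen h) (gen h)
  lift≢graft t∈ t∈′ with ∈-map⁻ lift t∈ | ∈-grafts⁻ (gen h) (gen h) t∈′
  ... | _ , _ , refl | _ , _ , _ , ()
  leaf∉ : ∀ {t} → t ∈ map lift (gen h) ++ grafts (gen h) (gen h) → leaf ≢ t
  leaf∉ t∈ refl with ∈-++⁻ (map lift (gen h)) t∈
  ... | inj₁ t∈′ with ∈-map⁻ lift t∈′
  ...   | _ , _ , ()
  leaf∉ t∈ refl | inj₂ t∈′ with ∈-grafts⁻ (gen h) (gen h) t∈′
  ...   | _ , _ , _ , ()

∈-gen : ∀ t {h} → size t < h → t ∈ gen h
∈-gen leaf (s≤s _) = here refl
∈-gen (lift t) (s≤s lt) = there (∈-++⁺ˡ (∈-map⁺ lift (∈-gen t lt)))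
∈-gen (graft p j q) {suc h} (s≤s lt) = there (∈-++⁺ʳ (map lift (gen h)) (∈-concatMap⁺ _
  (Any.map
    (λ { refl → ∈-concatMap⁺ _ (Any.map
      (λ { refl → ∈-map⁺ (graft p j) (∈-gen q (≤-<-trans (m≤n+m (size q) (size p)) lt)) }) (∈-allFin j)) })
    (∈-gen p (≤-<-trans (m≤m+n (size p) (size q)) lt)))))

_≟ˢ_ : DecidableEquality Step
N ≟ˢ N = yes refl
N ≟ˢ E = no λ ()
E ≟ˢ N = no λ ()
E ≟ˢ E = yes refl

_≟ᵖ_ : DecidableEquality Path
_≟ᵖ_ = ≡-dec _≟ˢ_

-- The N in front of `v` comes from the first letter, which turns a descent from the length of the
-- initial E run into an excursion.
over? : ∀ v t → Dec (base (upper t) ≡ N ∷ v)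
over? v t = base (upper t) ≟ᵖ (N ∷ v)

-- drop 1 removes the letter push d₀ standing for the initial E^d₀ of v.
ends : Tree → Path × Path
ends t = drop 1 (steps (lower t)) , drop 1 (steps (upper t))

treesOver : ℕ → Path → List Tree
treesOver h v = filter (over? v) (gen h)

-- Trees over `v` have size `1 + length v`, and `gen h` is complete for sizes below `h`; hence
-- `2 + length v`.
intervals : Path → List (Path × Path)
intervals v = map ends (treesOver (2 + length v) v)

lower-descent : ∀ t → Descent 0 (lower t)
lower-descent t = ≼-descent⁻ (Sound.lower≼upper (sound t)) (Sound.upper-descent (sound t))

base-lower : ∀ t → base (lower t) ≡ base (upper t)
base-lower t = ≼-base (Sound.lower≼upper (sound t))

steps-N : ∀ {w v} → Descent 0 w → base w ≡ N ∷ v → steps w ≡ N ∷ drop 1 (steps w)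
steps-N {push _ ∷ w} _ _ = refl

steps-determined : ∀ {w w′ v} → Descent 0 w → Descent 0 w′ → base w ≡ N ∷ v → base w′ ≡ N ∷ v →
  drop 1 (steps w) ≡ drop 1 (steps w′) → w ≡ w′
steps-determined {w} {w′} p p′ eq eq′ same = word-injective w w′ (trans eq (sym eq′))
  (trans (steps-N p eq) (trans (cong (N ∷_) same) (sym (steps-N p′ eq′))))

ends-injective : ∀ {v} t t′ → base (upper t) ≡ N ∷ v → base (upper t′) ≡ N ∷ v → ends t ≡ ends t′ → t ≡ t′
ends-injective t t′ eq eq′ same = decode-injective t t′
  (steps-determined (lower-descent t) (lower-descent t′)
    (trans (base-lower t) eq) (trans (base-lower t′) eq′) (cong proj₁ same))
  (steps-determined (Sound.upper-descent (sound t)) (Sound.upper-descent (sound t′))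
    eq eq′ (cong proj₂ same))

unique-intervals : ∀ v → Unique (intervals v)
unique-intervals v = unique-map ends
  (λ {t} {t′} t∈ t′∈ → ends-injective t t′ (over t∈) (over t′∈))
  (Unique.filter⁺ (over? v) (unique-gen (2 + length v)))
  where
  over : ∀ {t} → t ∈ treesOver (2 + length v) v → base (upper t) ≡ N ∷ v
  over t∈ = proj₂ (∈-filter⁻ (over? v) {xs = gen (2 + length v)} t∈)

length-raise : ∀ w → length (raise w) ≡ length w
length-raise [] = refl
length-raise (push _ ∷ w) = refl
length-raise (pop ∷ w) = refl

size-upper : ∀ t → size t ≡ length (upper t)
size-upper leaf = refl
size-upper (lift t) = cong suc (size-upper t)
size-upper (graft p j q) = sym (trans (length-++ (raise (upper p)))
  (trans (cong₂ _+_ (trans (length-raise (upper p)) (sym (size-upper p))) (cong suc (sym (size-upper q))))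
    (+-suc (size p) (size q))))

size-base : ∀ t → size t ≡ length (base (upper t))
size-base t = trans (size-upper t) (trans (sym (length-map step (upper t)))
  (proj₁ (proj₂ (descent⇒tam (Sound.upper-descent (sound t))))))

ends-interval : ∀ {v} t → base (upper t) ≡ N ∷ v → Interval v (ends t)
ends-interval {v} t eq =
  go (lower t) (upper t) (lower-descent t) (Sound.upper-descent (sound t)) (Sound.lower≼upper (sound t)) eq
  where
  go : ∀ w w′ → Descent 0 w → Descent 0 w′ → w ≼ w′ → base w′ ≡ N ∷ v →
    Interval v (drop 1 (steps w) , drop 1 (steps w′))
  go [] (_ ∷ _) _ _ s _ with ≼-length s
  ... | ()
  go (push d ∷ w) w′ _ p s eq with ≼-push s
  ... | w₁ , refl , s′ = subst (λ u → Interval u (steps w , steps w₁)) (∷-injectiveʳ eq)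
                           (≼⇒interval (descent-push⁻ p) s′)

interval-tree : ∀ {v r} → Interval v r → ∃[ t ] (base (upper t) ≡ N ∷ v × r ≡ ends t)
interval-tree {v} {p , q} i with interval⇒≼ i
... | h , w , w′ , desc , s , refl , refl , refl
  with complete _ (push h ∷ w) (push h ∷ w′) ≤-refl (descent-push desc) (≼-++ˡ (push h ∷ []) s)
... | t , eq , eq′ = t , cong base eq′ ,
  cong₂ (λ a b → drop 1 (steps a) , drop 1 (steps b)) (sym eq) (sym eq′)

∈-intervals : ∀ v r → (r ∈ intervals v) ⇔ Interval v r
∈-intervals v r = mk⇔ to from
  where
  to : r ∈ intervals v → Interval v r
  to r∈ with ∈-map⁻ ends r∈
  ... | t , t∈ , refl = ends-interval t (proj₂ (∈-filter⁻ (over? v) {xs = gen (2 + length v)} t∈))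
  from : Interval v r → r ∈ intervals v
  from i with interval-tree i
  ... | t , eq , refl = ∈-map⁺ ends (∈-filter⁺ (over? v)
          (∈-gen t (s≤s (≤-reflexive (trans (size-base t) (cong length eq))))) eq)

Σpaths : ℕ → (Path → ℕ) → ℕ
Σpaths n f = sum (map f (allPaths n))

Σpaths-suc : ∀ n f → Σpaths (suc n) f ≡ Σpaths n (f ∘ (N ∷_)) + Σpaths n (f ∘ (E ∷_))
Σpaths-suc n f = trans (cong sum (map-++ f (map (N ∷_) (allPaths n)) _))
  (trans (sum-++ (map f (map (N ∷_) (allPaths n))) _)
    (cong₂ (λ a b → sum a + sum b) (sym (map-∘ (allPaths n))) (sym (map-∘ (allPaths n)))))

Σpaths-cong : ∀ n {f g} → (∀ v → length v ≡ n → f v ≡ g v) → Σpaths n f ≡ Σpaths n g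
Σpaths-cong zero eq = cong (_+ 0) (eq [] refl)
Σpaths-cong (suc n) {f} {g} eq = trans (Σpaths-suc n f) (trans
  (cong₂ _+_ (Σpaths-cong n λ v l → eq (N ∷ v) (cong suc l)) (Σpaths-cong n λ v l → eq (E ∷ v) (cong suc l)))
  (sym (Σpaths-suc n g)))

Σpaths-0 : ∀ n → Σpaths n (λ _ → 0) ≡ 0
Σpaths-0 zero = refl
Σpaths-0 (suc n) = trans (Σpaths-suc n _) (cong₂ _+_ (Σpaths-0 n) (Σpaths-0 n))

Σpaths-+ : ∀ n f g → Σpaths n (λ v → f v + g v) ≡ Σpaths n f + Σpaths n g
Σpaths-+ n f g = go (allPaths n)
  where
  go : ∀ vs → sum (map (λ v → f v + g v) vs) ≡ sum (map f vs) + sum (map g vs)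
  go [] = refl
  go (v ∷ vs) = trans (cong (f v + g v +_) (go vs)) (+-interchange (f v) (g v) _ _)
    where
    +-interchange : ∀ a b c d → (a + b) + (c + d) ≡ (a + c) + (b + d)
    +-interchange a b c d = trans (+-assoc a b _) (trans (cong (a +_) (trans (sym (+-assoc b c d))
      (trans (cong (_+ d) (+-comm b c)) (+-assoc c b d)))) (sym (+-assoc a c _)))

indicator : Path → Path → ℕ
indicator p q = if does (p ≟ᵖ q) then 1 else 0

Σpaths-indicator : ∀ n p → Σpaths n (indicator p) ≡ δ (length p) n
Σpaths-indicator zero [] = refl
Σpaths-indicator zero (_ ∷ _) = refl
Σpaths-indicator (suc n) [] = trans (Σpaths-suc n _) (cong₂ _+_ (Σpaths-0 n) (Σpaths-0 n))
Σpaths-indicator (suc n) (N ∷ p) = trans (Σpaths-suc n _)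
  (trans (cong₂ _+_ (Σpaths-indicator n p) (Σpaths-0 n)) (+-identityʳ _))
Σpaths-indicator (suc n) (E ∷ p) = trans (Σpaths-suc n _) (cong₂ _+_ (Σpaths-0 n) (Σpaths-indicator n p))

-- A tree other than `leaf` lies over exactly one path, shorter than its size by the added N; `leaf`
-- lies over none.
Σpaths-over : ∀ n t → Σpaths n (λ v → indicator (base (upper t)) (N ∷ v)) ≡ δ (size t) (suc n)
Σpaths-over n t = trans (go (base (upper t)) refl) (cong (λ m → δ m (suc n)) (sym (size-base t)))
  where
  go : ∀ p → base (upper t) ≡ p → Σpaths n (λ v → indicator p (N ∷ v)) ≡ δ (length p) (suc n)
  go [] _ = Σpaths-0 n
  go (N ∷ p) _ = Σpaths-indicator n p
  go (E ∷ p) eq = contradiction eq (base≢E (upper t))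

length-filter-∷ : ∀ v t ts → length (filter (over? v) (t ∷ ts)) ≡
  indicator (base (upper t)) (N ∷ v) + length (filter (over? v) ts)
length-filter-∷ v t ts with over? v t
... | yes _ = refl
... | no _  = refl

count-trees : ∀ n ts → Σpaths n (λ v → length (filter (over? v) ts)) ≡ sum (map (λ t → δ (size t) (suc n)) ts)
count-trees n [] = Σpaths-0 n
count-trees n (t ∷ ts) = trans (Σpaths-cong n (λ v _ → length-filter-∷ v t ts))
  (trans (Σpaths-+ n _ _) (cong₂ _+_ (Σpaths-over n t) (count-trees n ts)))

total-coefficient : ∀ K h n → TreeSum.total (Truncation.R K) τ h n ≡ sum (map (λ t → δ (size t) n) (gen h))
total-coefficient K h n = go (gen h)
  where
  open Truncation K
  go : ∀ ts → L₁.Σ ts (S₁.weigh (λ _ → R.1#)) n ≡ sum (map (λ t → δ (size t) n) ts)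
  go [] = refl
  go (t ∷ ts) = cong₂ _+_
    (trans (P.⊛-comm (τ ^ size t) R.1# n)
      (trans (P.const-⊛ 1 _ n) (trans (*-identityˡ _) (τ^ (size t) n))))
    (go ts)
    where open import Algebra.Properties.Semiring.Exp R.semiring using (_^_)

theorem1 : ∀ (n : ℕ) →
    ∃[ c ] ((∀ v → HasCard (Interval v) (c v)) ×
    sum (map c (allPaths n)) * ((n + 2) !) * ((2 * n + 3) !) ≡ 2 * ((3 * n + 3) !))
theorem1 n = (length ∘ intervals) ,
  (λ v → intervals v , unique-intervals v , ∈-intervals v , refl) ,
  total-! n (Σpaths n (length ∘ intervals))
    -- At degree `suc n` the constant series has coefficient 0, and `2 + n` is the least precision
    -- that keeps this degree.
    (trans (cong₂ _+_ count (sym (trans (+-identityʳ _) (ternary-⊛ (suc n) 1 1))))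
      (Truncation.total-eq (2 + n) (suc n) ≤-refl))
  where
  count : Σpaths n (length ∘ intervals) ≡ TreeSum.total (Truncation.R (2 + n)) τ (2 + n) (suc n)
  count = begin
    Σpaths n (length ∘ intervals)
      ≡⟨ Σpaths-cong n (λ v l → trans (length-map ends (treesOver (2 + length v) v))
                                      (cong (λ m → length (treesOver (2 + m) v)) l)) ⟩
    Σpaths n (λ v → length (treesOver (2 + n) v))
      ≡⟨ count-trees n (gen (2 + n)) ⟩
    sum (map (λ t → δ (size t) (suc n)) (gen (2 + n)))
      ≡⟨ total-coefficient (2 + n) (2 + n) (suc n) ⟨
    TreeSum.total (Truncation.R (2 + n)) τ (2 + n) (suc n) ∎
    where open ≡-Reasoning
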